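{- Let $k=k(n)$ satisfy $k=\omega(n)$, and for each $n$ let $\Gamma=(U,\Pi)$ be a restricted NOF protocol that solves the Multiphase game $\mathsf{SEL}^{k}_{\mathsf{DISJ}_n}$ (correctly on every input $(\vec S,T,i)$) with advice length $|U|=o(k)$ bits. Then $|\Pi|:=\max_{i\in[k]}|\Pi_i|\ge\Omega(\sqrt n)$; that is, there exist $c>0$ and $n_0$ such that for every $n\ge n_0$ there is an index $i\in[k]$ with $|\Pi_i|\ge c\sqrt n$.
   Context: Set disjointness: for $A,B\subseteq[n]$, $\mathsf{DISJ}_n(A,B)=1$ if $A\cap B=\emptyset$ and $0$ otherwise. Multiphase game $\mathsf{SEL}^{k}_{\mathsf{DISJ}_n}$ (3-party Number-On-Forehead). The input is $\vec S=(S_1,\dots,S_k)$ with $S_i\subseteq[n]$, a set $T\subseteq[n]$, and an index $i\in[k]$. Alice sees $(\vec S,i)$, Bob sees $(T,i)$, Charlie sees $(\vec S,T)$ but not $i$. The goal is to compute $\mathsf{DISJ}_n(S_i,T)$. A (deterministic) protocol $\Gamma=(U,\Pi)$ proceeds as follows. First Charlie sends a message ("advice") $U=U(\vec S,T)$ privately to Bob (Alice does not see it). Then Alice and Bob communicate back and forth, with any number of rounds; each message of Alice is a function of $(\vec S,i)$ and the Alice–Bob transcript so far, and each message of Bob is a function of $(T,i,U)$ and the Alice–Bob transcript so far. $\Pi_i$ denotes the transcript of this second stage when the index is $i$, and it determines the output. $|U|$ and $|\Pi_i|$ denote the maximum number of bits of $U$, resp. $\Pi_i$, over all $\vec S,T$.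 The protocol is restricted if Alice is the first speaker in the second stage, only her first message may depend on all of $(\vec S,i)$, and each of her later messages depends only on $S_i$, $i$ and the Alice–Bob transcript so far. There is no further restriction on Bob or Charlie. (Equivalent 4-party formulation: a fourth player Megan, who sees $(\vec S,i)$, broadcasts one message to Alice and Bob, counted in $|\Pi_i|$; Alice, who sees only $(S_i,i)$, and Bob, who sees $(T,i,U)$, then communicate.) -}

module Defs where

open import Data.Bool.Base using (Bool; true; false; if_then_else_)
open import Data.Empty using (⊥)
open import Data.Fin.Base using (Fin)
open import Data.Fin.Subset using (Subset; _∩_)
open import Data.Fin.Subset.Properties using (nonempty?)
open import Data.Integer.Base using (+_)
open import Data.List.Base using (List; []; _∷_; length)
open import Data.Nat.Base using (ℕ; zero; suc; _*_; _≤_; _≥_; _⊔_)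
open import Data.Product.Base using (_×_; _,_; ∃-syntax)
open import Data.Rational.Base as ℚ using (ℚ)
open import Data.Unit.Base using (⊤)
open import Data.Vec.Base as Vec using (Vec; lookup)
open import Relation.Binary.PropositionalEquality.Core using (_≡_)
open import Relation.Nullary.Decidable using (does; ¬?)

-- The small constant ε > 0 ranges over the reciprocals 1 / C.
_is-o_ : (ℕ → ℕ) → (ℕ → ℕ) → Set
f is-o g = ∀ (C : ℕ) → ∃[ N ] (∀ n → n ≥ N → C * f n ≤ g n)

_is-ω_ : (ℕ → ℕ) → (ℕ → ℕ) → Set
f is-ω g = g is-o f

ℕ→ℚ : ℕ → ℚ
ℕ→ℚ n = + n ℚ./ 1

-- x ≥ c √ n  means  x ≥ c·√n.  Both sides are squared to avoid the
-- square root, so this reading is only correct for c ≥ 0.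
_≥_√_ : ℕ → ℚ → ℕ → Set
x ≥ c √ n = (c ℚ.* c) ℚ.* ℕ→ℚ n ℚ.≤ ℕ→ℚ (x * x)

-- The first argument of maxVec takes maxima over the type of entries.

maxBool : (Bool → ℕ) → ℕ
maxBool f = f false ⊔ f true

maxVec : {A : Set} → ((A → ℕ) → ℕ) → (m : ℕ) → (Vec A m → ℕ) → ℕ
maxVec maxA zero    f = f Vec.[]
maxVec maxA (suc m) f = maxA (λ a → maxVec maxA m (λ v → f (a Vec.∷ v)))

maxSubset : (n : ℕ) → (Subset n → ℕ) → ℕ
maxSubset n = maxVec maxBool n

DISJ : ∀ {n} → Subset n → Subset n → Bool
DISJ A B = does (¬? (nonempty? (A ∩ B)))

-- X and Y are what Alice and Bob see.  Each step sends one bit.  A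
-- position in the tree is the transcript so far; it determines who
-- speaks next or, at a leaf, the output.  A message is a maximal block
-- of consecutive bits by one speaker.
data Tree (X Y : Set) : Set where
  output : Bool → Tree X Y
  alice  : (X → Bool) → (t₀ t₁ : Tree X Y) → Tree X Y
  bob    : (Y → Bool) → (t₀ t₁ : Tree X Y) → Tree X Y

module _ {X Y : Set} where

  transcript : Tree X Y → X → Y → List Bool
  transcript (output b)      x y = []
  transcript (alice f t₀ t₁) x y =
    f x ∷ (if f x then transcript t₁ x y else transcript t₀ x y)
  transcript (bob g t₀ t₁)   x y =
    g y ∷ (if g y then transcript t₁ x y else transcript t₀ x y)

  result : Tree X Y → X → Y → Bool
  result (output b)      x y = b
  result (alice f t₀ t₁) x y = if f x then result t₁ x y else result t₀ x y
  result (bob g t₀ t₁)   x y = if g y then result t₁ x y else result t₀ x y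

-- Alice sees S⃗, Bob sees T and the advice; the index, which both of
-- them see, selects the tree.
record Protocol (n k : ℕ) : Set where
  field
    U : Vec (Subset n) k → Subset n → List Bool
    Π : Fin k → Tree (Vec (Subset n) k) (Subset n × List Bool)

module _ {n k : ℕ} where

  maxInput : (Vec (Subset n) k → Subset n → ℕ) → ℕ
  maxInput f = maxVec (maxSubset n) k (λ S → maxSubset n (λ T → f S T))

  ∣U∣ : Protocol n k → ℕ
  ∣U∣ Γ = maxInput (λ S T → length (U S T))
    where open Protocol Γ

  ∣Π∣ : Protocol n k → Fin k → ℕ
  ∣Π∣ Γ i = maxInput (λ S T → length (transcript (Π i) S (T , U S T)))
    where open Protocol Γ

  Solves-SEL-DISJ : Protocol n k → Set
  Solves-SEL-DISJ Γ = ∀ S T i → result (Π i) S (T , U S T) ≡ DISJ (lookup S i) T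
    where open Protocol Γ

  SELTree : Set
  SELTree = Tree (Vec (Subset n) k) (Subset n × List Bool)

  DependsOnlyOn : Fin k → (Vec (Subset n) k → Bool) → Set
  DependsOnlyOn i f = ∀ S S′ → lookup S i ≡ lookup S′ i → f S ≡ f S′

  AfterFirstMessage : Fin k → SELTree → Set
  AfterFirstMessage i (output b)      = ⊤
  AfterFirstMessage i (alice f t₀ t₁) =
    DependsOnlyOn i f × AfterFirstMessage i t₀ × AfterFirstMessage i t₁
  AfterFirstMessage i (bob g t₀ t₁)   =
    AfterFirstMessage i t₀ × AfterFirstMessage i t₁

  -- Alice's first message lasts until Bob first speaks.
  DuringFirstMessage : Fin k → SELTree → Set
  DuringFirstMessage i (output b)      = ⊤
  DuringFirstMessage i (alice f t₀ t₁) =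
    DuringFirstMessage i t₀ × DuringFirstMessage i t₁
  DuringFirstMessage i (bob g t₀ t₁)   =
    AfterFirstMessage i t₀ × AfterFirstMessage i t₁

  AliceSpeaksFirst : SELTree → Set
  AliceSpeaksFirst (output b)      = ⊤
  AliceSpeaksFirst (alice f t₀ t₁) = ⊤
  AliceSpeaksFirst (bob g t₀ t₁)   = ⊥

  Restricted : Protocol n k → Set
  Restricted Γ = ∀ i → AliceSpeaksFirst (Π i) × DuringFirstMessage i (Π i)
    where open Protocol Γ

{-# OPTIONS --safe #-}

-- Restrict every set to one element from each of p ≈ √n blocks of size p,
-- so that disjointness is sparse but has constant probability.
--
-- For a fixed index i, the histories of Charlie's advice on a sequence of
-- sets T₁ , T₂ , … and Alice's first message leave a set of values of S_i
-- that are still possible.  If a next set T hardly shrinks it, then on that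
-- T the rest of Π_i is an ordinary two-party protocol that is right for
-- nearly all of the remaining values, Bob's input being T with the advice
-- that Charlie gives on the actual input.  Were this so for most T, a
-- corruption bound for disjointness would force Ω(√n) bits of
-- communication.  Hence a cheap protocol admits, for every input, a sequence
-- of r = O(√n) sets each of which shrinks a constant fraction of the k sets
-- of remaining values by a constant factor.  The product of these k sets
-- contains all inputs with the same sequence, advice and first messages, so
-- there are at least 2 ^ Ω(rk) such combinations; but they are described by
-- (n + |U| + 1) r + k max |Π_i| bits, which is too few.
module Submission where

open import Data.Bool.Base using (Bool; true; false; if_then_else_; not; _∧_)
import Data.Bool.Properties as Bool
open import Data.Empty using (⊥; ⊥-elim)
open import Data.Fin.Base using (Fin; zero; suc; _↑ˡ_; _↑ʳ_; splitAt)
import Data.Fin.Properties as Fin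
open import Data.Fin.Subset using (Subset; _∩_; ⁅_⁆)
open import Data.Fin.Subset.Properties using (nonempty?; x∈p∩q⁻; x∈p∩q⁺; x∈⁅x⁆; x∈⁅y⁆⇒x≡y)
import Data.Integer.Base as ℤ
import Data.Integer.Properties as ℤ
open import Data.List.Base as List
  using (List; []; _∷_; _++_; length; map; filterᵇ; allFin; cartesianProduct; cartesianProductWith)
open import Data.List.Membership.Propositional using (_∈_; lose)
open import Data.List.Membership.Propositional.Properties
  using (∈-allFin; ∈-map⁺; ∈-++⁺ˡ; ∈-++⁺ʳ; ∈-cartesianProduct⁺; ∈-cartesianProductWith⁺)
open import Data.List.Properties using (length-tabulate; length-map; length-++; ≡-dec; ∷-injectiveʳ)
open import Data.List.Relation.Binary.Sublist.Propositional using (_⊆_; []; _∷_; _∷ʳ_; ⊆-refl; ⊆-trans)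
open import Data.List.Relation.Binary.Sublist.Propositional.Properties using (filter-⊆)
open import Data.List.Relation.Unary.Any as Any using (Any; here; there; any?)
open import Data.Nat
open import Data.Nat.Properties
open import Data.Nat.Tactic.RingSolver using (solve-∀)
open import Data.Product.Base using (_×_; _,_; ∃-syntax; proj₁; proj₂)
import Data.Product.Properties as Product
open import Data.Rational.Base as ℚ using (ℚ; 0ℚ)
import Data.Rational.Properties as ℚ
import Data.Rational.Unnormalised.Base as ℚᵘ
import Data.Rational.Unnormalised.Properties as ℚᵘ
open import Data.Sum.Base using (_⊎_; inj₁; inj₂; map₂; [_,_]′)
open import Data.Unit.Base using (tt)
open import Data.Vec.Base as Vec using (Vec; lookup; _[_]≔_)
import Data.Vec.Properties as Vec
open import Function.Base using (_∘_; id)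
open import Relation.Binary.Definitions using (DecidableEquality)
open import Relation.Binary.PropositionalEquality
open import Relation.Nullary using (yes; no; contradiction; ¬_; Dec; does)
open import Relation.Nullary.Decidable using (T?; toSum; ¬?; _×-dec_; _⊎-dec_; dec-true; dec-false)
open import Defs

variable
  A B C : Set

-- Finite sums over lists, also used for counting.

⟦_⟧ : Bool → ℕ
⟦ true ⟧  = 1
⟦ false ⟧ = 0

∑ : List A → (A → ℕ) → ℕ
∑ []       f = 0
∑ (x ∷ xs) f = f x + ∑ xs f

syntax ∑ xs (λ x → e) = ∑[ x ∈ xs ] e

count : (A → Bool) → List A → ℕ
count p xs = ∑[ x ∈ xs ] ⟦ p x ⟧

∑-mono∈ : ∀ (xs : List A) {f g} → (∀ {x} → x ∈ xs → f x ≤ g x) → ∑ xs f ≤ ∑ xs g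
∑-mono∈ []       f≤g = z≤n
∑-mono∈ (x ∷ xs) f≤g = +-mono-≤ (f≤g (here refl)) (∑-mono∈ xs (f≤g ∘ there))

∑-mono : ∀ (xs : List A) {f g} → (∀ x → f x ≤ g x) → ∑ xs f ≤ ∑ xs g
∑-mono xs f≤g = ∑-mono∈ xs λ {x} _ → f≤g x

∑-cong∈ : ∀ (xs : List A) {f g} → (∀ {x} → x ∈ xs → f x ≡ g x) → ∑ xs f ≡ ∑ xs g
∑-cong∈ []       f≡g = refl
∑-cong∈ (x ∷ xs) f≡g = cong₂ _+_ (f≡g (here refl)) (∑-cong∈ xs (f≡g ∘ there))

∑-cong : ∀ (xs : List A) {f g} → (∀ x → f x ≡ g x) → ∑ xs f ≡ ∑ xs g
∑-cong xs f≡g = ∑-cong∈ xs λ {x} _ → f≡g x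

∑-+ : ∀ (xs : List A) f g → ∑[ x ∈ xs ] (f x + g x) ≡ ∑ xs f + ∑ xs g
∑-+ []       f g = refl
∑-+ (x ∷ xs) f g rewrite ∑-+ xs f g = lemma (f x) (g x) (∑ xs f) (∑ xs g)
  where
  lemma : ∀ a b c d → a + b + (c + d) ≡ a + c + (b + d)
  lemma = solve-∀

∑-*ˡ : ∀ c (xs : List A) f → ∑[ x ∈ xs ] (c * f x) ≡ c * ∑ xs f
∑-*ˡ c []       f = sym (*-zeroʳ c)
∑-*ˡ c (x ∷ xs) f rewrite ∑-*ˡ c xs f = sym (*-distribˡ-+ c (f x) _)

∑-*ʳ : ∀ (xs : List A) f c → ∑[ x ∈ xs ] (f x * c) ≡ ∑ xs f * c
∑-*ʳ xs f c = trans (∑-cong xs λ x → *-comm (f x) c) (trans (∑-*ˡ c xs f) (*-comm c _))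

∑-const : ∀ (xs : List A) c → ∑[ x ∈ xs ] c ≡ length xs * c
∑-const []       c = refl
∑-const (x ∷ xs) c = cong (c +_) (∑-const xs c)

∑-swap : ∀ (xs : List A) (ys : List B) (f : A → B → ℕ) →
         ∑[ x ∈ xs ] ∑[ y ∈ ys ] f x y ≡ ∑[ y ∈ ys ] ∑[ x ∈ xs ] f x y
∑-swap []       ys f = sym (trans (∑-const ys 0) (*-zeroʳ (length ys)))
∑-swap (x ∷ xs) ys f rewrite ∑-swap xs ys f = sym (∑-+ ys (f x) _)

∑-++ : ∀ (xs ys : List A) f → ∑ (xs ++ ys) f ≡ ∑ xs f + ∑ ys f
∑-++ []       ys f = refl
∑-++ (x ∷ xs) ys f rewrite ∑-++ xs ys f = sym (+-assoc (f x) _ _)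

∑-map : ∀ (h : A → B) xs f → ∑ (map h xs) f ≡ ∑ xs (f ∘ h)
∑-map h []       f = refl
∑-map h (x ∷ xs) f = cong (f (h x) +_) (∑-map h xs f)

∑-product : ∀ (h : A → B → C) xs ys f →
            ∑ (cartesianProductWith h xs ys) f ≡ ∑[ x ∈ xs ] ∑[ y ∈ ys ] f (h x y)
∑-product h []       ys f = refl
∑-product h (x ∷ xs) ys f rewrite ∑-++ (map (h x) ys) (cartesianProductWith h xs ys) f =
  cong₂ _+_ (∑-map (h x) ys f) (∑-product h xs ys f)

length≡∑1 : ∀ (xs : List A) → length xs ≡ ∑[ x ∈ xs ] 1
length≡∑1 xs = sym (trans (∑-const xs 1) (*-identityʳ _))

∑-∈ : ∀ {xs : List A} f {x} → x ∈ xs → f x ≤ ∑ xs f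
∑-∈ f (here refl) = m≤m+n _ _
∑-∈ f (there x∈)  = ≤-trans (∑-∈ f x∈) (m≤n+m _ _)

∑-⊆ : ∀ {xs ys : List A} f → xs ⊆ ys → ∑ xs f ≤ ∑ ys f
∑-⊆ f []         = z≤n
∑-⊆ f (y ∷ʳ s)   = ≤-trans (∑-⊆ f s) (m≤n+m _ (f y))
∑-⊆ f (refl ∷ s) = +-monoʳ-≤ _ (∑-⊆ f s)

∑-filter : ∀ p (xs : List A) f → ∑ (filterᵇ p xs) f ≡ ∑[ x ∈ xs ] (⟦ p x ⟧ * f x)
∑-filter p []       f = refl
∑-filter p (x ∷ xs) f with p x
... | true  = cong₂ _+_ (sym (*-identityˡ (f x))) (∑-filter p xs f)
... | false = ∑-filter p xs f

∑-split : ∀ p (xs : List A) f → ∑ xs f ≡ ∑ (filterᵇ p xs) f + ∑ (filterᵇ (not ∘ p) xs) f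
∑-split p []       f = refl
∑-split p (x ∷ xs) f rewrite ∑-split p xs f with p x
... | true  = sym (+-assoc (f x) _ _)
... | false = lemma (f x) (∑ (filterᵇ p xs) f) (∑ (filterᵇ (not ∘ p) xs) f)
  where
  lemma : ∀ a b c → a + (b + c) ≡ b + (a + c)
  lemma = solve-∀

length-filter : ∀ p (xs : List A) → length (filterᵇ p xs) ≡ count p xs
length-filter p xs = trans (length≡∑1 (filterᵇ p xs))
  (trans (∑-filter p xs _) (∑-cong xs λ x → *-identityʳ ⟦ p x ⟧))

filter-∈ : ∀ p (xs : List A) {x} → x ∈ filterᵇ p xs → p x ≡ true
filter-∈ p (x ∷ xs) x∈ with p x in eq
filter-∈ p (x ∷ xs) (here refl) | true  = eq
filter-∈ p (x ∷ xs) (there x∈)  | true  = filter-∈ p xs x∈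
filter-∈ p (x ∷ xs) x∈          | false = filter-∈ p xs x∈

∑-average : ∀ (xs : List A) f {c} → 0 < length xs → length xs * c ≤ ∑ xs f → ∃[ x ] c ≤ f x
∑-average (x ∷ xs) f {c} _ l with c ≤? f x
... | yes p = x , p
∑-average (x ∷ []) f {c} _ l | no c≰ = contradiction (subst₂ _≤_ (+-identityʳ c) (+-identityʳ (f x)) l) c≰
∑-average (x ∷ ys@(_ ∷ _)) f {c} _ l | no c≰ =
  ∑-average ys f z<s (+-cancelˡ-≤ c _ _ (≤-trans l (+-monoˡ-≤ _ (<⇒≤ (≰⇒> c≰)))))

∑-tabulate : ∀ {m} (h : Fin m → A) f → ∑ (List.tabulate h) f ≡ ∑ (allFin m) (f ∘ h)
∑-tabulate {m = zero}  h f = refl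
∑-tabulate {m = suc m} h f = cong (f (h zero) +_) (trans (∑-tabulate (h ∘ suc) f) (sym (∑-tabulate suc (f ∘ h))))

-- Finite products and sums over tuples.

∏ : ∀ {m} → (Fin m → ℕ) → ℕ
∏ {zero}  f = 1
∏ {suc m} f = f zero * ∏ (f ∘ suc)

∏-mono : ∀ {m} {f g : Fin m → ℕ} → (∀ i → f i ≤ g i) → ∏ f ≤ ∏ g
∏-mono {zero}  f≤g = ≤-refl
∏-mono {suc m} f≤g = *-mono-≤ (f≤g zero) (∏-mono (f≤g ∘ suc))

∏-cong : ∀ {m} {f g : Fin m → ℕ} → (∀ i → f i ≡ g i) → ∏ f ≡ ∏ g
∏-cong {zero}  f≡g = refl
∏-cong {suc m} f≡g = cong₂ _*_ (f≡g zero) (∏-cong (f≡g ∘ suc))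

∏-* : ∀ {m} (f g : Fin m → ℕ) → ∏ (λ i → f i * g i) ≡ ∏ f * ∏ g
∏-* {zero}  f g = refl
∏-* {suc m} f g rewrite ∏-* (f ∘ suc) (g ∘ suc) =
  [m*n]*[o*p]≡[m*o]*[n*p] (f zero) (g zero) _ _

∏-const : ∀ m c → ∏ {m} (λ _ → c) ≡ c ^ m
∏-const zero    c = refl
∏-const (suc m) c = cong (c *_) (∏-const m c)

∏-^ : ∀ {m} c (w : Fin m → ℕ) → ∏ (λ i → c ^ w i) ≡ c ^ ∑ (allFin m) w
∏-^ {zero}  c w = refl
∏-^ {suc m} c w rewrite ∏-^ c (w ∘ suc) = trans (sym (^-distribˡ-+-* c (w zero) _))
  (cong (λ z → c ^ (w zero + z)) (sym (∑-tabulate {A = Fin (suc m)} suc w)))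

tuples : List A → (m : ℕ) → List (Vec A m)
tuples xs zero    = Vec.[] ∷ []
tuples xs (suc m) = cartesianProductWith Vec._∷_ xs (tuples xs m)

-- The distributive law: expanding a product of sums picks one summand per coordinate. Independence
-- of the blocks of a point, and of the `k` sets of an input, is used in this form.
∑-tuples-∏ : ∀ (xs : List A) m (f : Fin m → A → ℕ) →
             ∑[ v ∈ tuples xs m ] ∏ (λ i → f i (lookup v i)) ≡ ∏ (λ i → ∑ xs (f i))
∑-tuples-∏ xs zero    f = refl
∑-tuples-∏ xs (suc m) f = begin
  ∑[ v ∈ tuples xs (suc m) ] ∏ (λ i → f i (lookup v i))
    ≡⟨ ∑-product Vec._∷_ xs (tuples xs m) _ ⟩
  ∑[ x ∈ xs ] ∑[ v ∈ tuples xs m ] (f zero x * ∏ (λ i → f (suc i) (lookup v i)))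
    ≡⟨ ∑-cong xs (λ x → trans (∑-*ˡ (f zero x) (tuples xs m) _) (cong (f zero x *_) (∑-tuples-∏ xs m (f ∘ suc)))) ⟩
  ∑[ x ∈ xs ] (f zero x * ∏ (λ i → ∑ xs (f (suc i))))
    ≡⟨ ∑-*ʳ xs (f zero) _ ⟩
  ∑ xs (f zero) * ∏ (λ i → ∑ xs (f (suc i))) ∎
  where open ≡-Reasoning

length-tuples : ∀ (xs : List A) m → length (tuples xs m) ≡ length xs ^ m
length-tuples xs m = begin
  length (tuples xs m)                  ≡⟨ length≡∑1 (tuples xs m) ⟩
  ∑[ v ∈ tuples xs m ] 1                ≡⟨ ∑-cong (tuples xs m) (λ _ → sym (trans (∏-const m 1) (^-zeroˡ m))) ⟩
  ∑[ v ∈ tuples xs m ] ∏ {m} (λ i → 1)  ≡⟨ ∑-tuples-∏ xs m (λ _ _ → 1) ⟩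
  ∏ {m} (λ i → ∑[ x ∈ xs ] 1)           ≡⟨ ∏-const m _ ⟩
  (∑[ x ∈ xs ] 1) ^ m                   ≡⟨ cong (_^ m) (sym (length≡∑1 xs)) ⟩
  length xs ^ m                         ∎
  where open ≡-Reasoning

∈-tuples : ∀ {xs : List A} {m} (v : Vec A m) → (∀ i → lookup v i ∈ xs) → v ∈ tuples xs m
∈-tuples Vec.[]       v∈ = here refl
∈-tuples (x Vec.∷ v) v∈ = ∈-cartesianProductWith⁺ Vec._∷_ (v∈ zero) (∈-tuples v (v∈ ∘ suc))

-- Chebyshev's sum inequality and power means.

private
  rearrangement : ∀ a b c d → a ≤ b → c ≤ d → a * d + b * c ≤ a * c + b * d
  rearrangement a b c d a≤b c≤d with m≤n⇒∃[o]m+o≡n a≤b | m≤n⇒∃[o]m+o≡n c≤d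
  ... | x , refl | y , refl = ≤-trans (m≤m+n _ (x * y)) (≤-reflexive (lemma a x c y))
    where
    lemma : ∀ a x c y → a * (c + y) + (a + x) * c + x * y ≡ a * c + (a + x) * (c + y)
    lemma = solve-∀

  rearrangement-^ : ∀ q a b → a * b ^ q + a ^ q * b ≤ a * a ^ q + b * b ^ q
  rearrangement-^ q a b rewrite *-comm (a ^ q) b with ≤-total a b
  ... | inj₁ a≤b = rearrangement a b _ _ a≤b (^-monoˡ-≤ q a≤b)
  ... | inj₂ b≤a = subst₂ _≤_ (+-comm (b * a ^ q) _) (+-comm (b * b ^ q) _)
                     (rearrangement b a _ _ b≤a (^-monoˡ-≤ q b≤a))

-- Induction on the list. The new entry meets every old one in a cross term, and `rearrangement-^`
-- bounds it because an entry and its `q`-th power are ordered alike.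
chebyshev-^ : ∀ q (xs : List A) f →
              ∑ xs f * ∑[ x ∈ xs ] (f x ^ q) ≤ length xs * ∑[ x ∈ xs ] (f x ^ suc q)
chebyshev-^ q []       f = z≤n
chebyshev-^ q (x ∷ xs) f = begin
  (a + F) * (a ^ q + G)                                  ≡⟨ expand a F (a ^ q) G ⟩
  a * a ^ q + (a * G + a ^ q * F) + F * G                ≤⟨ +-mono-≤ (+-monoʳ-≤ (a * a ^ q) cross) (chebyshev-^ q xs f) ⟩
  a * a ^ q + (l * (a * a ^ q) + H) + l * H              ≡⟨ collect (a * a ^ q) l H ⟩
  (1 + l) * (a * a ^ q + H)                              ∎
  where
  open ≤-Reasoning
  a = f x
  F = ∑ xs f
  G = ∑[ x ∈ xs ] (f x ^ q)
  H = ∑[ x ∈ xs ] (f x ^ suc q)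
  l = length xs
  expand : ∀ a F b G → (a + F) * (b + G) ≡ a * b + (a * G + b * F) + F * G
  expand = solve-∀
  collect : ∀ a l H → a + (l * a + H) + l * H ≡ (1 + l) * (a + H)
  collect = solve-∀
  cross : a * G + a ^ q * F ≤ l * (a * a ^ q) + H
  cross = begin
    a * G + a ^ q * F
      ≡⟨ sym (cong₂ _+_ (∑-*ˡ a xs _) (∑-*ˡ (a ^ q) xs f)) ⟩
    ∑[ y ∈ xs ] (a * f y ^ q) + ∑[ y ∈ xs ] (a ^ q * f y)
      ≡⟨ sym (∑-+ xs _ _) ⟩
    ∑[ y ∈ xs ] (a * f y ^ q + a ^ q * f y)
      ≤⟨ ∑-mono xs (λ y → rearrangement-^ q a (f y)) ⟩
    ∑[ y ∈ xs ] (a * a ^ q + f y * f y ^ q)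
      ≡⟨ ∑-+ xs _ _ ⟩
    ∑[ y ∈ xs ] (a * a ^ q) + H
      ≡⟨ cong (_+ H) (∑-const xs _) ⟩
    l * (a * a ^ q) + H ∎

-- Chebyshev's inequality, applied to `f` and its power, raises the exponent by one at the cost of a
-- factor `length xs`.
power-mean : ∀ q (xs : List A) f → ∑ xs f ^ suc q ≤ length xs ^ q * ∑[ x ∈ xs ] (f x ^ suc q)
power-mean zero    xs f = ≤-reflexive (trans (*-identityʳ _)
  (trans (∑-cong xs λ x → sym (*-identityʳ (f x))) (sym (+-identityʳ _))))
power-mean (suc q) xs f = begin
  F * F ^ suc q                                    ≤⟨ *-monoʳ-≤ F (power-mean q xs f) ⟩
  F * (l ^ q * ∑[ x ∈ xs ] (f x ^ suc q))          ≡⟨ lemma F (l ^ q) _ ⟩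
  l ^ q * (F * ∑[ x ∈ xs ] (f x ^ suc q))          ≤⟨ *-monoʳ-≤ (l ^ q) (chebyshev-^ (suc q) xs f) ⟩
  l ^ q * (l * ∑[ x ∈ xs ] (f x ^ suc (suc q)))    ≡⟨ lemma′ l (l ^ q) _ ⟩
  l ^ suc q * ∑[ x ∈ xs ] (f x ^ suc (suc q))      ∎
  where
  open ≤-Reasoning
  F = ∑ xs f
  l = length xs
  lemma : ∀ a b c → a * (b * c) ≡ b * (a * c)
  lemma = solve-∀
  lemma′ : ∀ a b c → b * (a * c) ≡ a * b * c
  lemma′ = solve-∀

-- Indicators of decidable properties.

⟦⟧-not : ∀ b → ⟦ b ⟧ + ⟦ not b ⟧ ≡ 1
⟦⟧-not true  = refl
⟦⟧-not false = refl

⟦⟧≤1 : ∀ b → ⟦ b ⟧ ≤ 1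
⟦⟧≤1 true  = ≤-refl
⟦⟧≤1 false = z≤n

not-true⇒false : ∀ {b} → not b ≡ true → b ≡ false
not-true⇒false {false} _ = refl

does⇒ : ∀ {P : Set} (d : Dec P) → does d ≡ true → P
does⇒ (yes p) _ = p

does⇒¬ : ∀ {P : Set} (d : Dec P) → does d ≡ false → ¬ P
does⇒¬ (no ¬p) _ = ¬p

∏⟦⟧-≤ : ∀ {m} {p : Fin m → Bool} {c} → ((∀ j → p j ≡ true) → 1 ≤ c) → ∏ (λ j → ⟦ p j ⟧) ≤ c
∏⟦⟧-≤ {zero}  h = h λ ()
∏⟦⟧-≤ {suc m} {p} h with p zero in eq
... | false = z≤n
... | true  = ≤-trans (≤-reflexive (+-identityʳ _)) (∏⟦⟧-≤ λ all → h λ { zero → eq ; (suc j) → all j })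

∏⟦⟧-≥ : ∀ {m} {p : Fin m → Bool} → (∀ j → p j ≡ true) → 1 ≤ ∏ (λ j → ⟦ p j ⟧)
∏⟦⟧-≥ {m} {p} all = ≤-reflexive (sym (trans (∏-cong λ j → cong ⟦_⟧ (all j)) (trans (∏-const m 1) (^-zeroˡ m))))

-- Points, regions and disjointness in blocks.

-- A point (x₁ , … , x_m) stands for the set that meets the b-th of m
-- blocks of size q exactly in its x_b-th element.
Point : ℕ → ℕ → Set
Point q m = Vec (Fin q) m

points : ∀ q m → List (Point q m)
points q m = tuples (allFin q) m

length-points : ∀ q m → length (points q m) ≡ q ^ m
length-points q m = trans (length-tuples (allFin q) m) (cong (_^ m) (length-tabulate {n = q} id))

∈-points : ∀ {q m} (x : Point q m) → x ∈ points q m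
∈-points x = ∈-tuples x λ i → ∈-allFin (lookup x i)

disjoint? : ∀ {q m} (x y : Point q m) → Dec (∀ b → lookup x b ≢ lookup y b)
disjoint? x y = Fin.all? λ b → ¬? (lookup x b Fin.≟ lookup y b)

disjoint : ∀ {q m} → Point q m → Point q m → Bool
disjoint x y = does (disjoint? x y)

-- An arbitrary subset of the union of the blocks, stored block by block. `inside W` and `outside W`
-- are the indicators of the points contained in `W` and of those disjoint from it.
Region : ℕ → ℕ → Set
Region q m = Vec (Vec Bool q) m

regions : ∀ q m → List (Region q m)
regions q m = tuples (tuples (true ∷ false ∷ []) q) m

module _ {q m : ℕ} where

  inside outside : Region q m → Point q m → ℕ
  inside  W x = ∏ λ b → ⟦ lookup (lookup W b) (lookup x b) ⟧
  outside W x = ∏ λ b → ⟦ not (lookup (lookup W b) (lookup x b)) ⟧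

  covers? : ∀ {t} (ys : Vec (Point q m) t) b c → Dec (∃[ j ] lookup (lookup ys j) b ≡ c)
  covers? ys b c = Fin.any? λ j → lookup (lookup ys j) b Fin.≟ c

  -- The union of the sets that the points `ys` stand for.
  covered : ∀ {t} → Vec (Point q m) t → Region q m
  covered ys = Vec.tabulate λ b → Vec.tabulate λ c → does (covers? ys b c)

  covered-lookup : ∀ {t} (ys : Vec (Point q m) t) b c →
    lookup (lookup (covered ys) b) c ≡ does (covers? ys b c)
  covered-lookup ys b c =
    trans (cong (λ v → lookup v c) (Vec.lookup∘tabulate _ b)) (Vec.lookup∘tabulate _ c)

  ∈-regions : ∀ W → W ∈ regions q m
  ∈-regions W = ∈-tuples W λ b → ∈-tuples (lookup W b) λ c → ∈-bools (lookup (lookup W b) c)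
    where
    ∈-bools : ∀ b → b ∈ true ∷ false ∷ []
    ∈-bools true  = here refl
    ∈-bools false = there (here refl)

  inside-covered : ∀ {t} (ys : Vec (Point q m) t) → 1 ≤ ∏ (λ j → inside (covered ys) (lookup ys j))
  inside-covered {t} ys = ≤-trans (≤-reflexive (sym (trans (∏-const t 1) (^-zeroˡ t))))
    (∏-mono λ j → ∏⟦⟧-≥ {m} λ b → trans (covered-lookup ys b _) (dec-true (covers? ys b _) (j , refl)))

  outside-covered : ∀ {t} x (ys : Vec (Point q m) t) →
                    ∏ (λ j → ⟦ disjoint x (lookup ys j) ⟧) ≤ outside (covered ys) x
  outside-covered x ys = ∏⟦⟧-≤ λ all → ∏⟦⟧-≥ λ b → cong not
    (trans (covered-lookup ys b _) (dec-false (covers? ys b _) λ (j , eq) → does⇒ (disjoint? x (lookup ys j)) (all j) b (sym eq)))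

  -- Blocks are independent. In a block where `W` has `w` elements and omits `w̄`, the contribution
  -- is `w * w̄`, at most a quarter of `q * q` since `w + w̄` is `q`.
  inside-outside-≤ : ∀ W → 4 ^ m * (∑ (points q m) (inside W) * ∑ (points q m) (outside W)) ≤ (q ^ m) * (q ^ m)
  inside-outside-≤ W = begin
    4 ^ m * (∑ (points q m) (inside W) * ∑ (points q m) (outside W))
      ≡⟨ cong₂ _*_ (sym (∏-const m 4)) (cong₂ _*_ (∑-tuples-∏ (allFin q) m _) (∑-tuples-∏ (allFin q) m _)) ⟩
    ∏ {m} (λ _ → 4) * (∏ w * ∏ w̄)
      ≡⟨ sym (trans (∏-* (λ _ → 4) (λ b → w b * w̄ b)) (cong (∏ {m} (λ _ → 4) *_) (∏-* w w̄))) ⟩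
    ∏ (λ b → 4 * (w b * w̄ b))
      ≤⟨ ∏-mono (λ b → ≤-trans (4ab≤[a+b]² (w b) (w̄ b)) (≤-reflexive (cong (λ z → z * z) (w+w̄ b)))) ⟩
    ∏ {m} (λ _ → q * q)
      ≡⟨ trans (∏-* {m} (λ _ → q) (λ _ → q)) (cong₂ _*_ (∏-const m q) (∏-const m q)) ⟩
    q ^ m * q ^ m ∎
    where
    open ≤-Reasoning
    w w̄ : Fin m → ℕ
    w b = ∑[ c ∈ allFin q ] ⟦ lookup (lookup W b) c ⟧
    w̄ b = ∑[ c ∈ allFin q ] ⟦ not (lookup (lookup W b) c) ⟧
    w+w̄ : ∀ b → w b + w̄ b ≡ q
    w+w̄ b = begin-equality
      w b + w̄ b              ≡⟨ sym (∑-+ (allFin q) _ _) ⟩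
      ∑ (allFin q) _         ≡⟨ ∑-cong (allFin q) (λ c → ⟦⟧-not (lookup (lookup W b) c)) ⟩
      ∑[ c ∈ allFin q ] 1    ≡⟨ sym (length≡∑1 (allFin q)) ⟩
      length (allFin q)      ≡⟨ length-tabulate {n = q} id ⟩
      q                      ∎
    4ab≤[a+b]² : ∀ a b → 4 * (a * b) ≤ (a + b) * (a + b)
    4ab≤[a+b]² a b with ≤-total a b
    ... | inj₁ a≤b with m≤n⇒∃[o]m+o≡n a≤b
    ...   | d , refl = ≤-trans (m≤m+n _ (d * d)) (≤-reflexive (lemma a d))
      where
      lemma : ∀ a d → 4 * (a * (a + d)) + d * d ≡ (a + (a + d)) * (a + (a + d))
      lemma = solve-∀
    4ab≤[a+b]² a b | inj₂ b≤a with m≤n⇒∃[o]m+o≡n b≤a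
    ...   | d , refl = ≤-trans (m≤m+n _ (d * d)) (≤-reflexive (lemma b d))
      where
      lemma : ∀ a d → 4 * ((a + d) * a) + d * d ≡ ((a + d) + a) * ((a + d) + a)
      lemma = solve-∀

-- The corruption bound for disjointness.

#disjoint #intersecting : ∀ {q m} → List (Point q m) → List (Point q m) → ℕ
#disjoint     A B = ∑[ x ∈ A ] ∑[ y ∈ B ] ⟦ disjoint x y ⟧
#intersecting A B = ∑[ x ∈ A ] ∑[ y ∈ B ] ⟦ not (disjoint x y) ⟧

∑-^ : ∀ (xs : List A) f t → ∑ xs f ^ t ≡ ∑[ v ∈ tuples xs t ] ∏ (λ j → f (lookup v j))
∑-^ xs f t = sym (trans (∑-tuples-∏ xs t (λ _ → f)) (∏-const t _))

*-^ : ∀ a b n → (a * b) ^ n ≡ a ^ n * b ^ n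
*-^ a b zero    = refl
*-^ a b (suc n) rewrite *-^ a b n = [m*n]*[o*p]≡[m*o]*[n*p] a b (a ^ n) (b ^ n)

^-cancelʳ-≤ : ∀ t .{{_ : NonZero t}} {a b} → a ^ t ≤ b ^ t → a ≤ b
^-cancelʳ-≤ t {a} {b} l with a ≤? b
... | yes a≤b = a≤b
... | no  a≰b = contradiction l (<⇒≱ (^-monoˡ-< t (≰⇒> a≰b)))

module _ {q m : ℕ} {X Y : List (Point q m)} (X⊆ : X ⊆ points q m) (Y⊆ : Y ⊆ points q m) where

  private
    N = q ^ m
    meet : ∀ {t} → Vec (Point q m) t → ℕ
    meet ys = ∑[ x ∈ X ] ∏ λ j → ⟦ disjoint x (lookup ys j) ⟧

  -- The sum counts pairs of `t`-tuples from `X` and `Y` all of whose cross pairs are disjoint. The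
  -- union of the `ys` is a region that contains every `ys` and avoids every `xs`. Summing over all
  -- `(2 ^ q) ^ m` regions and bounding each by `inside-outside-≤` gives the claim.
  ∑-meet-≤ : ∀ t → (4 ^ m) ^ t * ∑[ ys ∈ tuples Y t ] (meet ys ^ t) ≤ (2 ^ q) ^ m * (N * N) ^ t
  ∑-meet-≤ t = begin
    (4 ^ m) ^ t * ∑[ ys ∈ tuples Y t ] (meet ys ^ t)
      ≤⟨ *-monoʳ-≤ ((4 ^ m) ^ t) (∑-mono (tuples Y t) meet-≤) ⟩
    (4 ^ m) ^ t * ∑[ ys ∈ tuples Y t ] ∑[ W ∈ regions q m ] (∏ (λ j → inside W (lookup ys j)) * O W ^ t)
      ≡⟨ cong ((4 ^ m) ^ t *_) (trans (∑-swap (tuples Y t) (regions q m) _) (∑-cong (regions q m) λ W →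
           trans (∑-*ʳ (tuples Y t) _ _) (cong (_* O W ^ t) (sym (∑-^ Y (inside W) t))))) ⟩
    (4 ^ m) ^ t * ∑[ W ∈ regions q m ] (∑ Y (inside W) ^ t * O W ^ t)
      ≡⟨ sym (∑-*ˡ ((4 ^ m) ^ t) (regions q m) _) ⟩
    ∑[ W ∈ regions q m ] ((4 ^ m) ^ t * (∑ Y (inside W) ^ t * O W ^ t))
      ≡⟨ ∑-cong (regions q m) (λ W → sym (trans (*-^ (4 ^ m) _ t) (cong ((4 ^ m) ^ t *_) (*-^ (∑ Y (inside W)) (O W) t)))) ⟩
    ∑[ W ∈ regions q m ] ((4 ^ m * (∑ Y (inside W) * O W)) ^ t)
      ≤⟨ ∑-mono (regions q m) (λ W → ^-monoˡ-≤ t (≤-trans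
           (*-monoʳ-≤ (4 ^ m) (*-monoˡ-≤ (O W) (∑-⊆ (inside W) Y⊆))) (inside-outside-≤ W))) ⟩
    ∑[ W ∈ regions q m ] ((N * N) ^ t)
      ≡⟨ ∑-const (regions q m) _ ⟩
    length (regions q m) * (N * N) ^ t
      ≡⟨ cong (_* (N * N) ^ t) (trans (length-tuples (tuples (true ∷ false ∷ []) q) m) (cong (_^ m) (length-tuples (true ∷ false ∷ []) q))) ⟩
    (2 ^ q) ^ m * (N * N) ^ t ∎
    where
    open ≤-Reasoning
    O : Region q m → ℕ
    O W = ∑ (points q m) (outside W)
    meet-≤ : ∀ ys → meet ys ^ t ≤ ∑[ W ∈ regions q m ] (∏ (λ j → inside W (lookup ys j)) * O W ^ t)
    meet-≤ ys = begin
      meet ys ^ t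
        ≤⟨ ^-monoˡ-≤ t (≤-trans (∑-mono X λ x → outside-covered x ys) (∑-⊆ (outside (covered ys)) X⊆)) ⟩
      O (covered ys) ^ t
        ≤⟨ ≤-trans (≤-reflexive (sym (*-identityˡ _))) (*-monoˡ-≤ _ (inside-covered ys)) ⟩
      ∏ (λ j → inside (covered ys) (lookup ys j)) * O (covered ys) ^ t
        ≤⟨ ∑-∈ _ (∈-regions (covered ys)) ⟩
      ∑[ W ∈ regions q m ] (∏ (λ j → inside W (lookup ys j)) * O W ^ t) ∎

  -- The power mean inequality in both arguments replaces pairs of points
  -- by pairs of t-tuples of points.
  #disjoint-^ : ∀ s → let t = suc s in
    #disjoint X Y ^ (t * t) ≤ (length X ^ s) ^ t * ((length Y ^ t) ^ s * ∑[ ys ∈ tuples Y t ] (meet ys ^ t))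
  #disjoint-^ s = begin
    #disjoint X Y ^ (t * t)
      ≡⟨ sym (^-*-assoc (#disjoint X Y) t t) ⟩
    (#disjoint X Y ^ t) ^ t
      ≤⟨ ^-monoˡ-≤ t (power-mean s X _) ⟩
    (length X ^ s * ∑[ x ∈ X ] ((∑[ y ∈ Y ] ⟦ disjoint x y ⟧) ^ t)) ^ t
      ≡⟨ cong (λ z → (length X ^ s * z) ^ t) (trans (∑-cong X λ x → ∑-^ Y _ t) (∑-swap X (tuples Y t) _)) ⟩
    (length X ^ s * ∑ (tuples Y t) meet) ^ t
      ≡⟨ *-^ (length X ^ s) _ t ⟩
    (length X ^ s) ^ t * ∑ (tuples Y t) meet ^ t
      ≤⟨ *-monoʳ-≤ ((length X ^ s) ^ t) (power-mean s (tuples Y t) meet) ⟩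
    (length X ^ s) ^ t * (length (tuples Y t) ^ s * ∑[ ys ∈ tuples Y t ] (meet ys ^ t))
      ≡⟨ cong (λ z → (length X ^ s) ^ t * (z ^ s * ∑[ ys ∈ tuples Y t ] (meet ys ^ t))) (length-tuples Y t) ⟩
    (length X ^ s) ^ t * ((length Y ^ t) ^ s * ∑[ ys ∈ tuples Y t ] (meet ys ^ t)) ∎
    where
    open ≤-Reasoning
    t = suc s

module _ {s : ℕ} {X Y : List (Point (suc s) (suc s))}
  (X⊆ : X ⊆ points (suc s) (suc s)) (Y⊆ : Y ⊆ points (suc s) (suc s)) where

  private
    p = suc s
    N = p ^ p
    a = length X * length Y
    E = #disjoint X Y

  -- `#disjoint-^` turns density at least 3/4 of disjoint pairs into density at least (3/4)^(p²) of
  -- fully disjoint pairs of `p`-tuples, which `∑-meet-≤` caps. Tuples of length `p` are long enough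
  -- that the 2^(p²) regions cost only a factor 2^p per pair of points.
  mostly-disjoint⇒small : 3 * a ≤ 4 * E → 3 ^ p * a ≤ 2 ^ p * (N * N)
  mostly-disjoint⇒small h with length X * length Y in eq
  ... | zero    = ≤-trans (≤-reflexive (*-zeroʳ (3 ^ p))) z≤n
  -- A `p`-th root is taken after cancelling the (p²)-th power of the rectangle's size; this is why
  -- size zero is treated apart.
  ... | suc a-1 = ^-cancelʳ-≤ p (*-cancelˡ-≤ (suc a-1 ^ (p * p)) {{m^n≢0 (suc a-1) (p * p)}} (begin
    c ^ (p * p) * (3 ^ p * c) ^ p
      ≡⟨ cong (c ^ (p * p) *_) (trans (*-^ (3 ^ p) c p) (cong (_* c ^ p) (^-*-assoc 3 p p))) ⟩
    c ^ (p * p) * (3 ^ (p * p) * c ^ p)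
      ≡⟨ trans (lemma₁ (c ^ (p * p)) (3 ^ (p * p)) (c ^ p)) (cong (_* c ^ p) (sym (*-^ 3 c (p * p)))) ⟩
    (3 * c) ^ (p * p) * c ^ p
      ≤⟨ *-monoˡ-≤ (c ^ p) (^-monoˡ-≤ (p * p) h) ⟩
    (4 * E) ^ (p * p) * c ^ p
      ≡⟨ cong₂ _*_ (*-^ 4 E (p * p)) (trans (cong (_^ p) (sym eq)) (*-^ (length X) (length Y) p)) ⟩
    4 ^ (p * p) * E ^ (p * p) * (x ^ p * y ^ p)
      ≤⟨ *-monoˡ-≤ (x ^ p * y ^ p) (*-monoʳ-≤ (4 ^ (p * p)) (#disjoint-^ X⊆ Y⊆ s)) ⟩
    4 ^ (p * p) * ((x ^ s) ^ p * ((y ^ p) ^ s * F)) * (x ^ p * y ^ p)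
      ≡⟨ lemma₂ (4 ^ (p * p)) ((x ^ s) ^ p) ((y ^ p) ^ s) F (x ^ p) (y ^ p) ⟩
    (x ^ p * (x ^ s) ^ p) * (y ^ p * (y ^ p) ^ s) * (4 ^ (p * p) * F)
      ≡⟨ cong₂ _*_ (cong₂ _*_ (trans (sym (*-^ x (x ^ s) p)) (^-*-assoc x p p)) (^-*-assoc y p p))
                   (cong (_* F) (sym (^-*-assoc 4 p p))) ⟩
    x ^ (p * p) * y ^ (p * p) * ((4 ^ p) ^ p * F)
      ≡⟨ cong (_* ((4 ^ p) ^ p * F)) (trans (sym (*-^ x y (p * p))) (cong (_^ (p * p)) eq)) ⟩
    c ^ (p * p) * ((4 ^ p) ^ p * F)
      ≤⟨ *-monoʳ-≤ (c ^ (p * p)) (∑-meet-≤ X⊆ Y⊆ p) ⟩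
    c ^ (p * p) * ((2 ^ p) ^ p * (N * N) ^ p)
      ≡⟨ cong (c ^ (p * p) *_) (sym (*-^ (2 ^ p) (N * N) p)) ⟩
    c ^ (p * p) * (2 ^ p * (N * N)) ^ p ∎))
    where
    open ≤-Reasoning
    c = suc a-1
    x = length X
    y = length Y
    F = ∑[ ys ∈ tuples Y p ] ((∑[ x ∈ X ] ∏ λ j → ⟦ disjoint x (lookup ys j) ⟧) ^ p)
    lemma₁ : ∀ a b c → a * (b * c) ≡ b * a * c
    lemma₁ = solve-∀
    lemma₂ : ∀ a b c d e f → a * (b * (c * d)) * (e * f) ≡ (e * b) * (f * c) * (a * d)
    lemma₂ = solve-∀

  #disjoint+#intersecting : E + #intersecting X Y ≡ a
  #disjoint+#intersecting = begin
    E + #intersecting X Y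
      ≡⟨ sym (∑-+ X _ _) ⟩
    ∑[ x ∈ X ] (∑[ y ∈ Y ] ⟦ disjoint x y ⟧ + ∑[ y ∈ Y ] ⟦ not (disjoint x y) ⟧)
      ≡⟨ ∑-cong X (λ x → trans (sym (∑-+ Y _ _)) (trans (∑-cong Y λ y → ⟦⟧-not (disjoint x y)) (sym (length≡∑1 Y)))) ⟩
    ∑[ x ∈ X ] length Y
      ≡⟨ ∑-const X _ ⟩
    a ∎
    where open ≡-Reasoning

  -- Either at least a quarter of the pairs intersect, and the first summand suffices, or the
  -- rectangle is mostly disjoint, hence small, and the second does.
  corruption : 3 ^ p * E ≤ 3 ^ p * (3 * #intersecting X Y) + 2 ^ p * (N * N)
  corruption with 4 * E ≤? 3 * a
  ... | yes h = ≤-trans (*-monoʳ-≤ (3 ^ p) (+-cancelˡ-≤ (3 * E) _ _ (begin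
      3 * E + E                      ≡⟨ +-comm (3 * E) E ⟩
      4 * E                          ≤⟨ h ⟩
      3 * a                          ≡⟨ cong (3 *_) (sym #disjoint+#intersecting) ⟩
      3 * (E + #intersecting X Y)    ≡⟨ *-distribˡ-+ 3 E _ ⟩
      3 * E + 3 * #intersecting X Y  ∎))) (m≤m+n _ _)
    where open ≤-Reasoning
  ... | no h = begin
    3 ^ p * E                                           ≤⟨ *-monoʳ-≤ (3 ^ p) (≤-trans (m≤m+n E _) (≤-reflexive #disjoint+#intersecting)) ⟩
    3 ^ p * a                                           ≤⟨ mostly-disjoint⇒small (<⇒≤ (≰⇒> h)) ⟩
    2 ^ p * (N * N)                                     ≤⟨ m≤n+m _ _ ⟩
    3 ^ p * (3 * #intersecting X Y) + 2 ^ p * (N * N)   ∎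
    where open ≤-Reasoning

-- Corruption for protocol trees.

filterᵇ-⊆ : ∀ p {xs ys : List A} → xs ⊆ ys → filterᵇ p xs ⊆ ys
filterᵇ-⊆ p {xs} s = ⊆-trans (filter-⊆ (T? ∘ p) xs) s

-- Transcripts of more than ℓ bits do not count as accepting.
accepts : ∀ {X Y : Set} → ℕ → Tree X Y → X → Y → Bool
accepts ℓ       (output b)      x y = b
accepts zero    _               x y = false
accepts (suc ℓ) (alice f t₀ t₁) x y = if f x then accepts ℓ t₁ x y else accepts ℓ t₀ x y
accepts (suc ℓ) (bob g t₀ t₁)   x y = if g y then accepts ℓ t₁ x y else accepts ℓ t₀ x y

accepts≡result : ∀ {X Y : Set} (t : Tree X Y) {ℓ x y} →
                 length (transcript t x y) ≤ ℓ → accepts ℓ t x y ≡ result t x y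
accepts≡result (output b)      l = refl
accepts≡result (alice f t₀ t₁) {x = x} (s≤s l) with f x
... | true  = accepts≡result t₁ l
... | false = accepts≡result t₀ l
accepts≡result (bob g t₀ t₁) {y = y} (s≤s l) with g y
... | true  = accepts≡result t₁ l
... | false = accepts≡result t₀ l

-- Over 1-labelled leaf rectangles, the corruption bound θ adds up.
module Corruption
  {P Q : Set} (Ps : List P) (Qs : List Q) (d : P → Q → Bool) (K θ : ℕ)
  (corrupt : ∀ {A B} → A ⊆ Ps → B ⊆ Qs →
    K * ∑[ x ∈ A ] ∑[ y ∈ B ] ⟦ d x y ⟧ ≤ K * (3 * ∑[ x ∈ A ] ∑[ y ∈ B ] ⟦ not (d x y) ⟧) + θ)
  {X Y : Set} (e : P → X) (v : Q → Y)
  where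

  #right #wrong : ℕ → Tree X Y → List P → List Q → ℕ
  #right ℓ t A B = ∑[ x ∈ A ] ∑[ y ∈ B ] ⟦ accepts ℓ t (e x) (v y) ∧ d x y ⟧
  #wrong ℓ t A B = ∑[ x ∈ A ] ∑[ y ∈ B ] ⟦ accepts ℓ t (e x) (v y) ∧ not (d x y) ⟧

  private
    record Bound (ℓ a b : ℕ) : Set where
      constructor bound
      field bounded : K * a ≤ K * (3 * b) + 2 ^ ℓ * θ

    -- The two branches of a node each pay `2 ^ ℓ * θ`, which is exactly what one more bit of depth
    -- provides.
    add : ∀ {ℓ a₁ a₀ b₁ b₀} → Bound ℓ a₁ b₁ → Bound ℓ a₀ b₀ → Bound (suc ℓ) (a₁ + a₀) (b₁ + b₀)
    add {ℓ} {a₁} {a₀} {b₁} {b₀} (bound h₁) (bound h₀) = bound (subst₂ _≤_ (sym (*-distribˡ-+ K a₁ a₀)) (lemma K b₁ b₀ (2 ^ ℓ) θ) (+-mono-≤ h₁ h₀))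
      where
      lemma : ∀ K b c z θ → K * (3 * b) + z * θ + (K * (3 * c) + z * θ) ≡ K * (3 * (b + c)) + 2 * z * θ
      lemma = solve-∀

    ∑∑-0 : ∀ (A : List P) (B : List Q) → ∑[ x ∈ A ] ∑[ y ∈ B ] 0 ≡ 0
    ∑∑-0 A B = trans (∑-cong A λ _ → trans (∑-const B 0) (*-zeroʳ (length B))) (trans (∑-const A 0) (*-zeroʳ (length A)))

    nothing : ∀ ℓ A B b → Bound ℓ (∑[ x ∈ A ] ∑[ y ∈ B ] 0) b
    nothing ℓ A B b rewrite ∑∑-0 A B = bound (≤-trans (≤-reflexive (*-zeroʳ K)) z≤n)

    if-true : ∀ {C : Set} {b} {x y : C} → b ≡ true → (if b then x else y) ≡ x
    if-true refl = refl

    if-false : ∀ {C : Set} {b} {x y : C} → not b ≡ true → (if b then x else y) ≡ y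
    if-false {b = false} refl = refl

    alice-split : ∀ ℓ f t₀ t₁ A B (φ : P → Q → Bool) →
      ∑[ x ∈ A ] ∑[ y ∈ B ] ⟦ accepts (suc ℓ) (alice f t₀ t₁) (e x) (v y) ∧ φ x y ⟧ ≡
      ∑[ x ∈ filterᵇ (f ∘ e) A ] ∑[ y ∈ B ] ⟦ accepts ℓ t₁ (e x) (v y) ∧ φ x y ⟧ +
      ∑[ x ∈ filterᵇ (not ∘ f ∘ e) A ] ∑[ y ∈ B ] ⟦ accepts ℓ t₀ (e x) (v y) ∧ φ x y ⟧
    alice-split ℓ f t₀ t₁ A B φ = trans (∑-split (f ∘ e) A _) (cong₂ _+_
      (∑-cong∈ _ λ {x} x∈ → ∑-cong B λ y → cong (λ b → ⟦ b ∧ φ x y ⟧) (if-true (filter-∈ (f ∘ e) A x∈)))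
      (∑-cong∈ _ λ {x} x∈ → ∑-cong B λ y → cong (λ b → ⟦ b ∧ φ x y ⟧) (if-false (filter-∈ (not ∘ f ∘ e) A x∈))))

    bob-split : ∀ ℓ g t₀ t₁ A B (φ : P → Q → Bool) →
      ∑[ x ∈ A ] ∑[ y ∈ B ] ⟦ accepts (suc ℓ) (bob g t₀ t₁) (e x) (v y) ∧ φ x y ⟧ ≡
      ∑[ x ∈ A ] ∑[ y ∈ filterᵇ (g ∘ v) B ] ⟦ accepts ℓ t₁ (e x) (v y) ∧ φ x y ⟧ +
      ∑[ x ∈ A ] ∑[ y ∈ filterᵇ (not ∘ g ∘ v) B ] ⟦ accepts ℓ t₀ (e x) (v y) ∧ φ x y ⟧
    bob-split ℓ g t₀ t₁ A B φ = trans (∑-cong A λ x → trans (∑-split (g ∘ v) B _) (cong₂ _+_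
      (∑-cong∈ _ λ {y} y∈ → cong (λ b → ⟦ b ∧ φ x y ⟧) (if-true (filter-∈ (g ∘ v) B y∈)))
      (∑-cong∈ _ λ {y} y∈ → cong (λ b → ⟦ b ∧ φ x y ⟧) (if-false (filter-∈ (not ∘ g ∘ v) B y∈)))))
      (∑-+ A _ _)

    -- Every bit splits one side of the rectangle, so each node sees a rectangle again and `corrupt`
    -- applies at accepting leaves. Rejecting leaves and runs cut off for length have nothing on the
    -- left.
    tree-bound : ∀ ℓ t {A B} → A ⊆ Ps → B ⊆ Qs → Bound ℓ (#right ℓ t A B) (#wrong ℓ t A B)
    -- A leaf reached with `ℓ` bits to spare needs a single `θ`.
    tree-bound ℓ (output true) A⊆ B⊆ =
      bound (≤-trans (corrupt A⊆ B⊆) (+-monoʳ-≤ _ (≤-trans (≤-reflexive (sym (*-identityˡ θ))) (*-monoˡ-≤ θ (m^n>0 2 ℓ)))))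
    tree-bound ℓ       (output false)  {A} {B} _ _ = nothing ℓ A B (#wrong ℓ (output false) A B)
    tree-bound zero    t@(alice _ _ _) {A} {B} _ _ = nothing 0 A B (#wrong 0 t A B)
    tree-bound zero    t@(bob _ _ _)   {A} {B} _ _ = nothing 0 A B (#wrong 0 t A B)
    tree-bound (suc ℓ) (alice f t₀ t₁) {A} {B} A⊆ B⊆ =
      subst₂ (Bound (suc ℓ)) (sym (alice-split ℓ f t₀ t₁ A B d)) (sym (alice-split ℓ f t₀ t₁ A B (λ x y → not (d x y))))
        (add (tree-bound ℓ t₁ (filterᵇ-⊆ (f ∘ e) A⊆) B⊆)
             (tree-bound ℓ t₀ (filterᵇ-⊆ (not ∘ f ∘ e) A⊆) B⊆))
    tree-bound (suc ℓ) (bob g t₀ t₁) {A} {B} A⊆ B⊆ =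
      subst₂ (Bound (suc ℓ)) (sym (bob-split ℓ g t₀ t₁ A B d)) (sym (bob-split ℓ g t₀ t₁ A B (λ x y → not (d x y))))
        (add (tree-bound ℓ t₁ A⊆ (filterᵇ-⊆ (g ∘ v) B⊆))
             (tree-bound ℓ t₀ A⊆ (filterᵇ-⊆ (not ∘ g ∘ v) B⊆)))

  tree-corruption : ∀ ℓ t {A B} → A ⊆ Ps → B ⊆ Qs →
    K * #right ℓ t A B ≤ K * (3 * #wrong ℓ t A B) + 2 ^ ℓ * θ
  tree-corruption ℓ t A⊆ B⊆ = Bound.bounded (tree-bound ℓ t A⊆ B⊆)

-- Alice's first message and the tree that remains after it.

private variable k n : ℕ

firstMessage : ∀ {X Y : Set} → Tree X Y → X → List Bool
firstMessage (output b)      x = []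
firstMessage (alice f t₀ t₁) x = f x ∷ (if f x then firstMessage t₁ x else firstMessage t₀ x)
firstMessage (bob g t₀ t₁)   x = []

residual : ∀ {X Y : Set} → Tree X Y → X → Tree X Y
residual t@(output _)    x = t
residual (alice f t₀ t₁) x = if f x then residual t₁ x else residual t₀ x
residual t@(bob _ _ _)   x = t

transcript-split : ∀ {X Y : Set} (t : Tree X Y) x y →
                   transcript t x y ≡ firstMessage t x ++ transcript (residual t x) x y
transcript-split (output b)      x y = refl
transcript-split (alice f t₀ t₁) x y with f x
... | true  = cong (true ∷_) (transcript-split t₁ x y)
... | false = cong (false ∷_) (transcript-split t₀ x y)
transcript-split (bob g t₀ t₁)   x y = refl

result-residual : ∀ {X Y : Set} (t : Tree X Y) x y → result (residual t x) x y ≡ result t x y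
result-residual (output b)      x y = refl
result-residual (alice f t₀ t₁) x y with f x
... | true  = result-residual t₁ x y
... | false = result-residual t₀ x y
result-residual (bob g t₀ t₁)   x y = refl

-- The message spells out the path taken in the tree, so equal messages lead to the same node.
residual-cong : ∀ {X Y : Set} (t : Tree X Y) x x′ → firstMessage t x ≡ firstMessage t x′ → residual t x ≡ residual t x′
residual-cong (output b)      x x′ eq = refl
residual-cong (alice f t₀ t₁) x x′ eq with f x | f x′
residual-cong (alice f t₀ t₁) x x′ eq | true  | true  = residual-cong t₁ x x′ (∷-injectiveʳ eq)
residual-cong (alice f t₀ t₁) x x′ eq | false | false = residual-cong t₀ x x′ (∷-injectiveʳ eq)
residual-cong (bob g t₀ t₁)   x x′ eq = refl

residual-after : ∀ (i : Fin k) (t : SELTree {n}) S → DuringFirstMessage i t → AfterFirstMessage i (residual t S)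
residual-after i (output b)      S _         = _
residual-after i (alice f t₀ t₁) S (d₀ , d₁) with f S
... | true  = residual-after i t₁ S d₁
... | false = residual-after i t₀ S d₀
residual-after i (bob g t₀ t₁)   S d         = d

-- The use of restrictedness: once the first message is over, Alice's input matters only through its
-- `i`-th set, and the remaining game is an ordinary two-party one.
accepts-cong : ∀ (i : Fin k) (t : SELTree {n}) → AfterFirstMessage i t → ∀ ℓ {S S′} y →
               lookup S i ≡ lookup S′ i → accepts ℓ t S y ≡ accepts ℓ t S′ y
accepts-cong i (output b)      _ ℓ       y eq = refl
accepts-cong i (alice f t₀ t₁) _ zero    y eq = refl
accepts-cong i (bob g t₀ t₁)   _ zero    y eq = refl
accepts-cong i (alice f t₀ t₁) (df , d₀ , d₁) (suc ℓ) {S} {S′} y eq rewrite df S S′ eq with f S′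
... | true  = accepts-cong i t₁ d₁ ℓ y eq
... | false = accepts-cong i t₀ d₀ ℓ y eq
accepts-cong i (bob g t₀ t₁) (d₀ , d₁) (suc ℓ) y eq with g y
... | true  = accepts-cong i t₁ d₁ ℓ y eq
... | false = accepts-cong i t₀ d₀ ℓ y eq

-- Counting by fibres.

length-product : ∀ (xs : List A) (ys : List B) → length (cartesianProduct xs ys) ≡ length xs * length ys
length-product xs ys = trans (length≡∑1 (cartesianProduct xs ys)) (trans (∑-product _,_ xs ys _)
  (trans (∑-cong xs λ _ → sym (length≡∑1 ys)) (∑-const xs _)))

⟦does⟧≤ : ∀ {P : Set} (d : Dec P) {c} → (P → 1 ≤ c) → ⟦ does d ⟧ ≤ c
⟦does⟧≤ (yes p) h = h p
⟦does⟧≤ (no _)  h = z≤n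

-- The factor `e` lets the fibre bound be the fraction `K / e`. Double counting over `ys` needs the
-- bound only for values taken, the other fibres being empty.
pigeonhole : (_≟_ : DecidableEquality B) (f : A → B) (xs : List A) (ys : List B) → (∀ x → f x ∈ ys) →
             ∀ {e K} → (∀ x → e * count (λ x′ → does (f x′ ≟ f x)) xs ≤ K) → e * length xs ≤ length ys * K
pigeonhole _≟_ f xs ys f∈ {e} {K} fibre≤ = begin
  e * length xs                                  ≡⟨ cong (e *_) (length≡∑1 xs) ⟩
  e * ∑[ x ∈ xs ] 1                              ≤⟨ *-monoʳ-≤ e (∑-mono xs λ x → ≤-trans
                                                      (≤-reflexive (sym (cong ⟦_⟧ (dec-true (f x ≟ f x) refl)))) (∑-∈ _ (f∈ x))) ⟩
  e * ∑[ x ∈ xs ] ∑[ y ∈ ys ] ⟦ does (f x ≟ y) ⟧ ≡⟨ cong (e *_) (∑-swap xs ys _) ⟩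
  e * ∑[ y ∈ ys ] ∑[ x ∈ xs ] ⟦ does (f x ≟ y) ⟧ ≡⟨ sym (∑-*ˡ e ys _) ⟩
  ∑[ y ∈ ys ] (e * count (λ x → does (f x ≟ y)) xs) ≤⟨ ∑-mono ys fibre ⟩
  ∑[ y ∈ ys ] K                                  ≡⟨ ∑-const ys K ⟩
  length ys * K                                  ∎
  where
  open ≤-Reasoning
  fibre : ∀ y → e * count (λ x → does (f x ≟ y)) xs ≤ K
  fibre y with any? (λ x → f x ≟ y) xs
  ... | yes p = let x , fx≡y = Any.satisfied p in subst (λ y → e * count (λ x → does (f x ≟ y)) xs ≤ K) fx≡y (fibre≤ x)
  ... | no ¬p = ≤-trans (≤-trans (*-monoʳ-≤ e (∑-mono∈ xs λ {x} x∈ → ⟦does⟧≤ (f x ≟ y) {0} λ eq → contradiction (lose x∈ eq) ¬p))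
                  (≤-reflexive (trans (cong (e *_) (trans (∑-const xs 0) (*-zeroʳ (length xs)))) (*-zeroʳ e)))) z≤n

-- The ratio `a / c` is at most 1, so a bound with more factors `a / c` is the stronger one.
lower-exponent : ∀ a c .{{_ : NonZero c}} → a ≤ c → ∀ {w w′} → w ≤ w′ → ∀ {x y} → c ^ w′ * x ≤ a ^ w′ * y → c ^ w * x ≤ a ^ w * y
lower-exponent a c a≤c {w} w≤w′ {x} {y} h with m≤n⇒∃[o]m+o≡n w≤w′
... | d , refl = *-cancelˡ-≤ (c ^ d) {{m^n≢0 c d}} (begin
  c ^ d * (c ^ w * x)  ≡⟨ lemma (c ^ d) (c ^ w) x ⟩
  c ^ w * c ^ d * x    ≡⟨ cong (_* x) (sym (^-distribˡ-+-* c w d)) ⟩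
  c ^ (w + d) * x      ≤⟨ h ⟩
  a ^ (w + d) * y      ≡⟨ cong (_* y) (^-distribˡ-+-* a w d) ⟩
  a ^ w * a ^ d * y    ≡⟨ sym (lemma (a ^ d) (a ^ w) y) ⟩
  a ^ d * (a ^ w * y)  ≤⟨ *-monoˡ-≤ (a ^ w * y) (^-monoˡ-≤ d a≤c) ⟩
  c ^ d * (a ^ w * y)  ∎)
  where
  open ≤-Reasoning
  lemma : ∀ d w x → d * (w * x) ≡ w * d * x
  lemma = solve-∀

-- The greedy choice of sets and the number of labels.

-- Free of disjointness: `X` holds the values of a single S_i, `Y` those of T, `C` the advice and
-- `D` the first messages. A drop is a shrinkage by `a / suc a`, and `r` is the number of sets
-- chosen.
module Greedy
  {X Y C D : Set}
  (_≟X_ : DecidableEquality X) (_≟Y_ : DecidableEquality Y)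
  (_≟C_ : DecidableEquality C) (_≟D_ : DecidableEquality D)
  (Xs : List X) (∈Xs : ∀ x → x ∈ Xs) (Ys : List Y) (∈Ys : ∀ y → y ∈ Ys) (Cs : List C) (Ds : List D)
  {k : ℕ} (U : Vec X k → Y → C) (M : Fin k → Vec X k → D)
  (U∈ : ∀ S T → U S T ∈ Cs) (M∈ : ∀ i S → M i S ∈ Ds)
  (a r : ℕ)
  where

  private
    c = suc a
    N = length Xs
    inputs = tuples Xs k

  -- S′ looks like S to Bob on each set in the history h, and to Alice in
  -- her first message.
  Consistent : ∀ {j} → Vec X k → Fin k → Vec Y j → Vec X k → Set
  Consistent S i h S′ = Vec.map (U S′) h ≡ Vec.map (U S) h × M i S′ ≡ M i S

  -- The projection to coordinate `i` of the inputs consistent with `S`. The first messages for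
  -- other indices are not compared.
  Remains : ∀ {j} → Vec X k → Fin k → Vec Y j → X → Set
  Remains S i h x = Any (λ S′ → lookup S′ i ≡ x × Consistent S i h S′) inputs

  remains? : ∀ {j} S i (h : Vec Y j) x → Dec (Remains S i h x)
  remains? S i h x = any? (λ S′ → (lookup S′ i ≟X x) ×-dec
    Vec.≡-dec _≟C_ (Vec.map (U S′) h) (Vec.map (U S) h) ×-dec (M i S′ ≟D M i S)) inputs

  #remaining : ∀ {j} → Vec X k → Fin k → Vec Y j → ℕ
  #remaining S i h = count (λ x → does (remains? S i h x)) Xs

  remains-tail : ∀ {j} {S i} {h : Vec Y j} {y x} → Remains S i (y Vec.∷ h) x → Remains S i h x
  remains-tail = Any.map λ (eq , u , m) → eq , Vec.∷-injectiveʳ u , m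

  #remaining-≤ : ∀ {j} S i (h : Vec Y j) y → #remaining S i (y Vec.∷ h) ≤ #remaining S i h
  #remaining-≤ S i h y = ∑-mono Xs λ x → ⟦does⟧≤ (remains? S i (y Vec.∷ h) x) λ rem →
    ≤-reflexive (sym (cong ⟦_⟧ (dec-true (remains? S i h x) (remains-tail rem))))

  -- Once Small, an index counts as bad at every step: r drops could not
  -- have shrunk its remaining values any further.
  Small Bad : ∀ {j} → Vec X k → Fin k → Vec Y j → Y → Set
  Small S i h _ = c ^ r * #remaining S i h ≤ a ^ r * N
  Bad S i h y = c * #remaining S i (y Vec.∷ h) ≤ a * #remaining S i h ⊎ Small S i h y

  bad? : ∀ {j} S i (h : Vec Y j) y → Dec (Bad S i h y)
  bad? S i h y = (c * #remaining S i (y Vec.∷ h) ≤? a * #remaining S i h) ⊎-dec (c ^ r * #remaining S i h ≤? a ^ r * N)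

  bad : ∀ {j} S i (h : Vec Y j) y → Bool
  bad S i h y = does (bad? S i h y)

  module _ (0<∣Xs∣ : 0 < length Xs) (0<∣Ys∣ : 0 < length Ys) (b : ℕ) .{{_ : NonZero b}}
    (many-bad : ∀ S i {j} (h : Vec Y j) → length Ys ≤ b * count (bad S i h) Ys) where

    -- `weight i` counts the chosen sets that were bad for index `i`; each is worth one factor
    -- `a / c` in `shrunk`. `weight≤` keeps the exponent within the `r` drops that `Small` provides.
    record State (S : Vec X k) (j : ℕ) : Set where
      field
        history   : Vec Y j
        weight    : Fin k → ℕ
        weight≤   : ∀ i → weight i ≤ j
        shrunk    : ∀ i → c ^ weight i * #remaining S i history ≤ a ^ weight i * N
        progress  : j * k ≤ b * ∑ (allFin k) weight

    -- Double counting: for every index at least `1 / b` of the sets are bad, so some set is bad for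
    -- at least `1 / b` of the indices.
    bad-for-many : ∀ S {j} (h : Vec Y j) → ∃[ y ] k ≤ b * ∑[ i ∈ allFin k ] ⟦ bad S i h y ⟧
    bad-for-many S h = ∑-average Ys _ 0<∣Ys∣ (begin
      length Ys * k
        ≡⟨ trans (*-comm _ k) (sym (trans (∑-const (allFin k) _) (cong (_* length Ys) (length-tabulate {n = k} id)))) ⟩
      ∑[ i ∈ allFin k ] length Ys
        ≤⟨ ∑-mono (allFin k) (λ i → many-bad S i h) ⟩
      ∑[ i ∈ allFin k ] (b * ∑[ y ∈ Ys ] ⟦ bad S i h y ⟧)
        ≡⟨ ∑-*ˡ b (allFin k) _ ⟩
      b * ∑[ i ∈ allFin k ] ∑[ y ∈ Ys ] ⟦ bad S i h y ⟧
        ≡⟨ cong (b *_) (∑-swap (allFin k) Ys _) ⟩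
      b * ∑[ y ∈ Ys ] ∑[ i ∈ allFin k ] ⟦ bad S i h y ⟧
        ≡⟨ sym (∑-*ˡ b Ys _) ⟩
      ∑[ y ∈ Ys ] (b * ∑[ i ∈ allFin k ] ⟦ bad S i h y ⟧) ∎)
      where open ≤-Reasoning

    greedy : ∀ S j → j ≤ r → State S j
    greedy S zero _ = record
      { history = Vec.[] ; weight = λ _ → 0 ; weight≤ = λ _ → z≤n ; progress = z≤n
      ; shrunk = λ i → +-monoˡ-≤ 0 (≤-trans (∑-mono Xs λ x → ⟦does⟧≤ (remains? S i Vec.[] x) λ _ → ≤-refl)
                                            (≤-reflexive (sym (length≡∑1 Xs)))) }
    greedy S (suc j) j<r with greedy S j (<⇒≤ j<r)
    ... | st with bad-for-many S (State.history st)
    ... | y , many = record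
      { history  = y Vec.∷ history
      ; weight   = λ i → ⟦ bad S i history y ⟧ + weight i
      ; weight≤  = λ i → +-mono-≤ (⟦does⟧≤ (bad? S i history y) λ _ → ≤-refl) (weight≤ i)
      ; shrunk   = λ i → shrunk′ i (bad? S i history y)
      ; progress = ≤-trans (+-mono-≤ many progress) (≤-reflexive
          (trans (sym (*-distribˡ-+ b _ _)) (cong (b *_) (sym (∑-+ (allFin k) _ weight)))))
      }
      where
      open State st
      open ≤-Reasoning
      shrunk′ : ∀ i (d : Dec (Bad S i history y)) →
        c ^ (⟦ does d ⟧ + weight i) * #remaining S i (y Vec.∷ history) ≤ a ^ (⟦ does d ⟧ + weight i) * N
      shrunk′ i (no _) = ≤-trans (*-monoʳ-≤ (c ^ weight i) (#remaining-≤ S i history y)) (shrunk i)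
      -- No drop occurs here. `small` already grants `r` factors, and the new exponent is at most
      -- `suc j`, hence at most `r`.
      shrunk′ i (yes (inj₂ small)) =
        ≤-trans (*-monoʳ-≤ (c ^ suc (weight i)) (#remaining-≤ S i history y))
                (lower-exponent a c (n≤1+n a) (≤-trans (s≤s (weight≤ i)) j<r) small)
      shrunk′ i (yes (inj₁ drop)) = begin
        c * c ^ w * #remaining S i (y Vec.∷ history)    ≡⟨ lemma c (c ^ w) _ ⟩
        c ^ w * (c * #remaining S i (y Vec.∷ history))  ≤⟨ *-monoʳ-≤ (c ^ w) drop ⟩
        c ^ w * (a * #remaining S i history)            ≡⟨ lemma′ a (c ^ w) _ ⟩
        a * (c ^ w * #remaining S i history)            ≤⟨ *-monoʳ-≤ a (shrunk i) ⟩
        a * (a ^ w * N)                                 ≡⟨ sym (*-assoc a _ _) ⟩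
        a * a ^ w * N                                   ∎
        where
        w = weight i
        lemma : ∀ c d x → c * d * x ≡ d * (c * x)
        lemma = solve-∀
        lemma′ : ∀ a d x → d * (a * x) ≡ a * (d * x)
        lemma′ = solve-∀

    history : Vec X k → Vec Y r
    history S = State.history (greedy S r ≤-refl)

    Label : Set
    Label = Vec Y r × Vec C r × Vec D k

    label : Vec X k → Label
    label S = history S , Vec.map (U S) (history S) , Vec.tabulate (λ i → M i S)

    _≟L_ : DecidableEquality Label
    _≟L_ = Product.≡-dec (Vec.≡-dec _≟Y_) (Product.≡-dec (Vec.≡-dec _≟C_) (Vec.≡-dec _≟D_))

    labels : List Label
    labels = cartesianProduct (tuples Ys r) (cartesianProduct (tuples Cs r) (tuples Ds k))

    label∈ : ∀ S → label S ∈ labels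
    label∈ S = ∈-cartesianProduct⁺ (∈-tuples (history S) λ j → ∈Ys _)
      (∈-cartesianProduct⁺
        (∈-tuples _ λ j → subst (_∈ Cs) (sym (Vec.lookup-map j (U S) (history S))) (U∈ S _))
        (∈-tuples _ λ i → subst (_∈ Ds) (sym (Vec.lookup∘tabulate (λ i → M i S) i)) (M∈ i S)))

    ∈inputs : ∀ S → S ∈ inputs
    ∈inputs S = ∈-tuples S λ i → ∈Xs _

    -- The history is chosen depending on the input, so it is recorded in the label. With equal
    -- histories, `S′` is itself the consistent input that is asked for.
    same-label⇒remains : ∀ S S′ → label S′ ≡ label S → ∀ i → Remains S i (history S) (lookup S′ i)
    same-label⇒remains S S′ eq i = lose (∈inputs S′) (refl , trans (cong (Vec.map (U S′)) (sym h≡)) u≡ , m≡)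
      where
      h≡ : history S′ ≡ history S
      h≡ = cong proj₁ eq
      u≡ = cong (proj₁ ∘ proj₂) eq
      m≡ : M i S′ ≡ M i S
      m≡ = trans (sym (Vec.lookup∘tabulate (λ i → M i S′) i))
        (trans (cong (λ l → lookup (proj₂ (proj₂ l)) i) eq) (Vec.lookup∘tabulate (λ i → M i S) i))

    -- By `same-label⇒remains` a fibre lies in the box whose `i`-th side consists of the values
    -- remaining at `i`.
    fibre≤ : ∀ S → count (λ S′ → does (label S′ ≟L label S)) inputs ≤ ∏ λ i → #remaining S i (history S)
    fibre≤ S = begin
      count (λ S′ → does (label S′ ≟L label S)) inputs
        ≤⟨ ∑-mono inputs (λ S′ → ⟦does⟧≤ (label S′ ≟L label S) λ eq →
             ∏⟦⟧-≥ {k} λ i → dec-true (remains? S i (history S) (lookup S′ i)) (same-label⇒remains S S′ eq i)) ⟩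
      ∑[ S′ ∈ inputs ] ∏ (λ i → ⟦ does (remains? S i (history S) (lookup S′ i)) ⟧)
        ≡⟨ ∑-tuples-∏ Xs k (λ i x → ⟦ does (remains? S i (history S) x) ⟧) ⟩
      ∏ (λ i → #remaining S i (history S)) ∎
      where open ≤-Reasoning

    -- Multiplying `shrunk` over all indices adds up the weights, and `progress` bounds their total
    -- `W` from below. As `W` depends on `S`, it is traded for the common exponent `w`.
    shrunk-fibre : ∀ S w → w * b ≤ r * k →
      c ^ w * count (λ S′ → does (label S′ ≟L label S)) inputs ≤ a ^ w * N ^ k
    shrunk-fibre S w wb≤rk = lower-exponent a c (n≤1+n a) w≤W (begin
      c ^ W * count (λ S′ → does (label S′ ≟L label S)) inputs
        ≤⟨ *-monoʳ-≤ (c ^ W) (fibre≤ S) ⟩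
      c ^ W * ∏ (λ i → #remaining S i (history S))
        ≡⟨ trans (cong (_* ∏ λ i → #remaining S i (history S)) (sym (∏-^ c weight))) (sym (∏-* (λ i → c ^ weight i) _)) ⟩
      ∏ (λ i → c ^ weight i * #remaining S i (history S))
        ≤⟨ ∏-mono shrunk ⟩
      ∏ (λ i → a ^ weight i * N)
        ≡⟨ trans (∏-* (λ i → a ^ weight i) _) (cong₂ _*_ (∏-^ a weight) (∏-const k N)) ⟩
      a ^ W * N ^ k ∎)
      where
      open ≤-Reasoning
      open State (greedy S r ≤-refl) using (weight; shrunk; progress)
      W = ∑ (allFin k) weight
      w≤W : w ≤ W
      w≤W = *-cancelʳ-≤ w W b (≤-trans wb≤rk (≤-trans progress (≤-reflexive (*-comm b W))))

    -- All `N ^ k` inputs are divided among fibres of size at most `(a / c) ^ w * N ^ k`.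
    labels-lower-bound : ∀ w → w * b ≤ r * k →
      c ^ w ≤ length Ys ^ r * (length Cs ^ r * length Ds ^ k) * a ^ w
    labels-lower-bound w h = *-cancelʳ-≤ _ _ (N ^ k) {{m^n≢0 N k {{>-nonZero 0<∣Xs∣}}}} (begin
      c ^ w * N ^ k
        ≡⟨ cong (c ^ w *_) (sym (length-tuples Xs k)) ⟩
      c ^ w * length inputs
        ≤⟨ pigeonhole _≟L_ label inputs labels label∈ {c ^ w} (λ S → shrunk-fibre S w h) ⟩
      length labels * (a ^ w * N ^ k)
        ≡⟨ trans (cong (_* (a ^ w * N ^ k)) #labels) (sym (*-assoc (length Ys ^ r * (length Cs ^ r * length Ds ^ k)) (a ^ w) (N ^ k))) ⟩
      length Ys ^ r * (length Cs ^ r * length Ds ^ k) * a ^ w * N ^ k ∎)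
      where
      open ≤-Reasoning
      #labels : length labels ≡ length Ys ^ r * (length Cs ^ r * length Ds ^ k)
      #labels = trans (length-product (tuples Ys r) _) (cong₂ _*_ (length-tuples Ys r)
        (trans (length-product (tuples Cs r) _) (cong₂ _*_ (length-tuples Cs r) (length-tuples Ds k))))

-- Points as subsets of [n].

record Embedding (q m n : ℕ) : Set where
  field
    embed : Point q m → Subset n
    meets⇒agrees : ∀ x y i → lookup (embed x) i ≡ true → lookup (embed y) i ≡ true → ∃[ b ] lookup x b ≡ lookup y b
    agrees⇒meets : ∀ x y b → lookup x b ≡ lookup y b → ∃[ i ] lookup (embed x) i ≡ true × lookup (embed y) i ≡ true

  DISJ-embed : ∀ x y → DISJ (embed x) (embed y) ≡ disjoint x y
  DISJ-embed x y with nonempty? (embed x ∩ embed y)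
  ... | yes (i , i∈) = sym (dec-false (disjoint? x y) λ d →
    let i∈x , i∈y = x∈p∩q⁻ (embed x) (embed y) i∈
        b , eq    = meets⇒agrees x y i (Vec.[]=⇒lookup i∈x) (Vec.[]=⇒lookup i∈y)
    in d b eq)
  ... | no ¬ne = sym (dec-true (disjoint? x y) λ b eq →
    let i , i∈x , i∈y = agrees⇒meets x y b eq
    in ¬ne (i , x∈p∩q⁺ (Vec.lookup⇒[]= i _ i∈x , Vec.lookup⇒[]= i _ i∈y)))

-- The blocks are consecutive intervals of length `q`, each carrying a singleton; the elements after
-- the last block belong to no set.
embedding : ∀ q m n → m * q ≤ n → Embedding q m n
embedding q zero    n _ = record
  { embed = λ _ → Vec.replicate n false
  ; meets⇒agrees = λ _ _ i eq → contradiction (trans (sym eq) (Vec.lookup-replicate i false)) λ ()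
  ; agrees⇒meets = λ _ _ () }
embedding q (suc m) n l with m≤n⇒∃[o]m+o≡n (≤-trans (m≤m+n q (m * q)) l)
... | o , refl = record { embed = embed ; meets⇒agrees = meets⇒agrees ; agrees⇒meets = agrees⇒meets }
  where
  module E = Embedding (embedding q m o (+-cancelˡ-≤ q _ _ l))
  embed : Point q (suc m) → Subset (q + o)
  embed (c Vec.∷ x) = ⁅ c ⁆ Vec.++ E.embed x
  lookup-⁅⁆ : ∀ (c d : Fin q) → lookup ⁅ d ⁆ c ≡ true → c ≡ d
  lookup-⁅⁆ c d eq = x∈⁅y⁆⇒x≡y d (Vec.lookup⇒[]= c _ eq)
  meets⇒agrees : ∀ x y i → lookup (embed x) i ≡ true → lookup (embed y) i ≡ true → ∃[ b ] lookup x b ≡ lookup y b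
  meets⇒agrees (c Vec.∷ x) (d Vec.∷ y) i i∈x i∈y
    rewrite Vec.lookup-splitAt q ⁅ c ⁆ (E.embed x) i | Vec.lookup-splitAt q ⁅ d ⁆ (E.embed y) i
    with splitAt q i
  ... | inj₁ a = zero , trans (sym (lookup-⁅⁆ a c i∈x)) (lookup-⁅⁆ a d i∈y)
  ... | inj₂ j = let b , eq = E.meets⇒agrees x y j i∈x i∈y in suc b , eq
  agrees⇒meets : ∀ x y b → lookup x b ≡ lookup y b → ∃[ i ] lookup (embed x) i ≡ true × lookup (embed y) i ≡ true
  agrees⇒meets (c Vec.∷ x) (.c Vec.∷ y) zero refl =
    c ↑ˡ o , trans (Vec.lookup-++ˡ ⁅ c ⁆ (E.embed x) c) c∈ , trans (Vec.lookup-++ˡ ⁅ c ⁆ (E.embed y) c) c∈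
    where c∈ = Vec.[]=⇒lookup (x∈⁅x⁆ c)
  agrees⇒meets (c Vec.∷ x) (d Vec.∷ y) (suc b) eq =
    let i , i∈x , i∈y = E.agrees⇒meets x y b eq
    in q ↑ʳ i , trans (Vec.lookup-++ʳ ⁅ c ⁆ (E.embed x) i) i∈x , trans (Vec.lookup-++ʳ ⁅ d ⁆ (E.embed y) i) i∈y

-- Bit strings of bounded length, and maxima over inputs.

strings : ℕ → List (List Bool)
strings zero    = [] ∷ []
strings (suc m) = [] ∷ map (true ∷_) (strings m) ++ map (false ∷_) (strings m)

-- Messages vary in length, so all lengths up to `m` are listed and the exact count is one less than
-- `2 ^ suc m`. Hence the exponents `suc u` and `suc ℓ` later on.
length-strings : ∀ m → length (strings m) < 2 ^ suc m
length-strings zero    = ≤-refl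
length-strings (suc m) = begin-strict
  suc (length (map (true ∷_) ss ++ map (false ∷_) ss))  ≡⟨ cong suc (length-++ (map (true ∷_) ss)) ⟩
  suc (length (map (true ∷_) ss) + length (map (false ∷_) ss))
    ≡⟨ cong suc (cong₂ _+_ (length-map (true ∷_) ss) (length-map (false ∷_) ss)) ⟩
  suc (length ss + length ss)                           <⟨ ≤-reflexive (lemma (length ss)) ⟩
  2 * suc (length ss)                                   ≤⟨ *-monoʳ-≤ 2 (length-strings m) ⟩
  2 ^ suc (suc m)                                       ∎
  where
  open ≤-Reasoning
  ss = strings m
  lemma : ∀ x → 2 + (x + x) ≡ 2 * (1 + x)
  lemma = solve-∀

∈-strings : ∀ {m} l → length l ≤ m → l ∈ strings m
∈-strings {zero}  []          _       = here refl
∈-strings {suc m} []          _       = here refl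
∈-strings {suc m} (true ∷ l)  (s≤s h) = there (∈-++⁺ˡ (∈-map⁺ (true ∷_) (∈-strings l h)))
∈-strings {suc m} (false ∷ l) (s≤s h) = there (∈-++⁺ʳ (map (true ∷_) (strings m)) (∈-map⁺ (false ∷_) (∈-strings l h)))

maxBool-≥ : ∀ f b → f b ≤ maxBool f
maxBool-≥ f false = m≤m⊔n _ _
maxBool-≥ f true  = m≤n⊔m (f false) _

maxVec-≥ : {maxA : (A → ℕ) → ℕ} → (∀ f a → f a ≤ maxA f) → ∀ {m} f (v : Vec A m) → f v ≤ maxVec maxA m f
maxVec-≥ maxA-≥ f Vec.[]      = ≤-refl
maxVec-≥ maxA-≥ f (a Vec.∷ v) = ≤-trans (maxVec-≥ maxA-≥ (λ v → f (a Vec.∷ v)) v) (maxA-≥ _ a)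

maxInput-≥ : ∀ {n k} f S T → f S T ≤ maxInput {n} {k} f
maxInput-≥ f S T = ≤-trans (maxVec-≥ maxBool-≥ (f S) T) (maxVec-≥ (maxVec-≥ maxBool-≥) _ S)

-- The density of disjoint pairs.

#equal : ∀ {q} (a : Fin q) → ∑[ c ∈ allFin q ] ⟦ does (a Fin.≟ c) ⟧ ≡ 1
#equal {suc q} zero    = cong suc (trans (∑-tabulate {A = Fin (suc q)} {m = q} suc _) (trans (∑-const (allFin q) 0) (*-zeroʳ (length (allFin q)))))
#equal {suc q} (suc a) = trans (∑-tabulate {A = Fin (suc q)} {m = q} suc _) (#equal a)

#distinct : ∀ {s} (a : Fin (suc s)) → ∑[ c ∈ allFin (suc s) ] ⟦ not (does (a Fin.≟ c)) ⟧ ≡ s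
#distinct {s} a = suc-injective (begin
  1 + D                                                           ≡⟨ cong (_+ D) (sym (#equal a)) ⟩
  ∑[ c ∈ allFin (suc s) ] ⟦ does (a Fin.≟ c) ⟧ + D                ≡⟨ sym (∑-+ (allFin (suc s)) (λ c → ⟦ does (a Fin.≟ c) ⟧) _) ⟩
  ∑ (allFin (suc s)) _                                            ≡⟨ ∑-cong (allFin (suc s)) (λ c → ⟦⟧-not (does (a Fin.≟ c))) ⟩
  ∑[ c ∈ allFin (suc s) ] 1                                       ≡⟨ sym (length≡∑1 (allFin (suc s))) ⟩
  length (allFin (suc s))                                         ≡⟨ length-tabulate {n = suc s} id ⟩
  suc s                                                           ∎)
  where
  open ≡-Reasoning
  D = ∑[ c ∈ allFin (suc s) ] ⟦ not (does (a Fin.≟ c)) ⟧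

-- In each block all but one of the `suc s` elements avoid `x`. For `m = suc s` the density is (1 -
-- 1/p)^p with p = `suc s`, a constant by `p^p≤4s^p`.
#disjoint-from : ∀ {s m} (x : Point (suc s) m) → s ^ m ≤ ∑[ y ∈ points (suc s) m ] ⟦ disjoint x y ⟧
#disjoint-from {s} {m} x = begin
  s ^ m
    ≡⟨ sym (trans (∏-cong λ b → #distinct (lookup x b)) (∏-const m s)) ⟩
  ∏ (λ b → ∑[ c ∈ allFin (suc s) ] ⟦ not (does (lookup x b Fin.≟ c)) ⟧)
    ≡⟨ sym (∑-tuples-∏ (allFin (suc s)) m _) ⟩
  ∑[ y ∈ points (suc s) m ] ∏ (λ b → ⟦ not (does (lookup x b Fin.≟ lookup y b)) ⟧)
    ≤⟨ ∑-mono (points (suc s) m) (λ y → ∏⟦⟧-≤ λ all → ≤-reflexive (sym (cong ⟦_⟧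
         (dec-true (disjoint? x y) λ b → does⇒ (¬? (lookup x b Fin.≟ lookup y b)) (all b))))) ⟩
  ∑[ y ∈ points (suc s) m ] ⟦ disjoint x y ⟧ ∎
  where open ≤-Reasoning

-- Arithmetic of right, wrong and missed pairs.

private
  module _ {N α K right wrong miss cB σ Z : ℕ}
    (many : α * σ ≤ right + miss + α * cB) (N≤4σ : N ≤ 4 * σ) (miss≤ : 40 * miss ≤ N * α)
    (cB≤ : 40 * cB ≤ N) (wrong≤ : wrong ≤ miss) (corrupt : K * right ≤ K * (3 * wrong) + Z) where
    open ≤-Reasoning

    -- Disjoint pairs have density at least 1/4; missed pairs and bad sets take away 1/40 each,
    -- which leaves 8/40.
    8Nα≤40right : 8 * (N * α) ≤ 40 * right
    8Nα≤40right = +-cancelʳ-≤ (2 * (N * α)) _ _ (begin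
      8 * (N * α) + 2 * (N * α)                    ≡⟨ lemma₁ N α ⟩
      10 * (α * N)                                 ≤⟨ *-monoʳ-≤ 10 (*-monoʳ-≤ α N≤4σ) ⟩
      10 * (α * (4 * σ))                           ≡⟨ lemma₂ α σ ⟩
      40 * (α * σ)                                 ≤⟨ *-monoʳ-≤ 40 many ⟩
      40 * (right + miss + α * cB)                 ≡⟨ lemma₃ right miss α cB ⟩
      40 * right + (40 * miss + α * (40 * cB))     ≤⟨ +-monoʳ-≤ (40 * right) (+-mono-≤ miss≤ (*-monoʳ-≤ α cB≤)) ⟩
      40 * right + (N * α + α * N)                 ≡⟨ lemma₄ right N α ⟩
      40 * right + 2 * (N * α)                     ∎)
      where
      lemma₁ : ∀ N α → 8 * (N * α) + 2 * (N * α) ≡ 10 * (α * N)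
      lemma₁ = solve-∀
      lemma₂ : ∀ α σ → 10 * (α * (4 * σ)) ≡ 40 * (α * σ)
      lemma₂ = solve-∀
      lemma₃ : ∀ r m α c → 40 * (r + m + α * c) ≡ 40 * r + (40 * m + α * (40 * c))
      lemma₃ = solve-∀
      lemma₄ : ∀ r N α → 40 * r + (N * α + α * N) ≡ 40 * r + 2 * (N * α)
      lemma₄ = solve-∀

    -- Density 8/40 is right and at most 1/40 is wrong, so the corruption bound leaves (8 - 3)/40 =
    -- 1/8 to be paid by `Z`.
    KNα≤8Z : K * (N * α) ≤ 8 * Z
    KNα≤8Z = *-cancelˡ-≤ 25 (+-cancelʳ-≤ (15 * (K * (N * α))) _ _ (begin
      25 * (K * (N * α)) + 15 * (K * (N * α))      ≡⟨ lemma₁ K (N * α) ⟩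
      5 * (K * (8 * (N * α)))                      ≤⟨ *-monoʳ-≤ 5 (*-monoʳ-≤ K 8Nα≤40right) ⟩
      5 * (K * (40 * right))                       ≡⟨ lemma₂ K right ⟩
      200 * (K * right)                            ≤⟨ *-monoʳ-≤ 200 corrupt ⟩
      200 * (K * (3 * wrong) + Z)                  ≤⟨ *-monoʳ-≤ 200 (+-monoˡ-≤ Z (*-monoʳ-≤ K (*-monoʳ-≤ 3 wrong≤))) ⟩
      200 * (K * (3 * miss) + Z)                   ≡⟨ lemma₃ K miss Z ⟩
      15 * (K * (40 * miss)) + 25 * (8 * Z)        ≤⟨ +-monoˡ-≤ (25 * (8 * Z)) (*-monoʳ-≤ 15 (*-monoʳ-≤ K miss≤)) ⟩
      15 * (K * (N * α)) + 25 * (8 * Z)            ≡⟨ +-comm (15 * (K * (N * α))) _ ⟩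
      25 * (8 * Z) + 15 * (K * (N * α))            ∎))
      where
      lemma₁ : ∀ K x → 25 * (K * x) + 15 * (K * x) ≡ 5 * (K * (8 * x))
      lemma₁ = solve-∀
      lemma₂ : ∀ K x → 5 * (K * (40 * x)) ≡ 200 * (K * x)
      lemma₂ = solve-∀
      lemma₃ : ∀ K m Z → 200 * (K * (3 * m) + Z) ≡ 15 * (K * (40 * m)) + 25 * (8 * Z)
      lemma₃ = solve-∀

count<length⇒false : ∀ p (xs : List A) → count p xs < length xs → ∃[ x ] p x ≡ false
count<length⇒false p (x ∷ xs) l with p x in eq
... | false = x , eq
... | true  = count<length⇒false p xs (s≤s⁻¹ l)

small-loss : ∀ a {α α′ kept lost} → a * α ≤ suc a * α′ → α′ ≤ kept → kept + lost ≡ α → suc a * lost ≤ α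
small-loss a {α} {α′} {kept} {lost} h α′≤kept eq = +-cancelʳ-≤ (a * α) _ _ (begin
  suc a * lost + a * α         ≤⟨ +-monoʳ-≤ (suc a * lost) (≤-trans h (*-monoʳ-≤ (suc a) α′≤kept)) ⟩
  suc a * lost + suc a * kept  ≡⟨ trans (sym (*-distribˡ-+ (suc a) lost kept)) (cong (suc a *_) (trans (+-comm lost kept) eq)) ⟩
  suc a * α                    ∎)
  where open ≤-Reasoning

-- Answers are correct whenever the value survives the set, so every fault can be charged to a pair
-- where it does not.
right-or-missed : ∀ {rem acc d} → (rem ≡ true → acc ≡ d) → ⟦ d ⟧ ≤ ⟦ acc ∧ d ⟧ + ⟦ not rem ⟧
right-or-missed {false} {acc}  {d}     h = ≤-trans (⟦⟧≤1 d) (m≤n+m 1 _)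
right-or-missed {true}  {_} {true} h rewrite h refl = ≤-refl
right-or-missed {true}  {_} {false} h = z≤n

wrong⇒missed : ∀ {rem acc d} → (rem ≡ true → acc ≡ d) → ⟦ acc ∧ not d ⟧ ≤ ⟦ not rem ⟧
wrong⇒missed {true}  {_}     {true}  h rewrite h refl = ≤-refl
wrong⇒missed {true}  {_}     {false} h rewrite h refl = ≤-refl
wrong⇒missed {false} {true}  {true}  h = z≤n
wrong⇒missed {false} {true}  {false} h = ≤-refl
wrong⇒missed {false} {false}         h = z≤n

-- From the protocol to many bad sets.

module Reduction {n k : ℕ} (Γ : Protocol n k) (restricted : Restricted Γ) (solves : Solves-SEL-DISJ Γ)
  {s : ℕ} (emb : Embedding (suc s) (suc s) n) {ℓ u : ℕ} (Π≤ : ∀ i → ∣Π∣ Γ i ≤ ℓ) (U≤ : ∣U∣ Γ ≤ u) (r : ℕ)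
  where

  open Protocol Γ
  open Embedding emb

  private
    p = suc s
    N = p ^ p
    Xs = points p p

  embeds : Vec (Point p p) k → Vec (Subset n) k
  embeds = Vec.map embed

  advice : Vec (Point p p) k → Point p p → List Bool
  advice S T = U (embeds S) (embed T)

  opening : Fin k → Vec (Point p p) k → List Bool
  opening i S = firstMessage (Π i) (embeds S)

  transcript≤ : ∀ i S T → length (transcript (Π i) (embeds S) (embed T , advice S T)) ≤ ℓ
  transcript≤ i S T = ≤-trans
    (maxInput-≥ (λ S T → length (transcript (Π i) S (T , U S T))) (embeds S) (embed T)) (Π≤ i)

  length-split : ∀ i S T → length (opening i S) + length (transcript (residual (Π i) (embeds S)) (embeds S) (embed T , advice S T)) ≤ ℓ
  length-split i S T = ≤-trans (≤-reflexive (sym (trans (cong length (transcript-split (Π i) (embeds S) (embed T , advice S T)))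
    (length-++ (opening i S))))) (transcript≤ i S T)

  open Greedy {Point p p} {Point p p} {List Bool} {List Bool}
    (Vec.≡-dec Fin._≟_) (Vec.≡-dec Fin._≟_) (≡-dec Bool._≟_) (≡-dec Bool._≟_)
    Xs ∈-points Xs ∈-points (strings u) (strings ℓ) advice opening
    (λ S T → ∈-strings (advice S T) (≤-trans (maxInput-≥ (λ S T → length (U S T)) (embeds S) (embed T)) U≤))
    -- The first message does not depend on T. To bound it by a whole transcript any T serves, here
    -- the all-`zero` point.
    (λ i S → ∈-strings (opening i S) (≤-trans (m≤m+n _ _) (length-split i S (Vec.replicate p zero))))
    -- With drops by 39/40, a set that is not bad loses at most 1/40 of the remaining values.
    39 r public

  module _ (S : Vec (Point p p) k) (i : Fin k) {j : ℕ} (h : Vec (Point p p) j) where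

    private
      t = residual (Π i) (embeds S)
      α = #remaining S i h

      𝒜 𝒢 ℬ : List (Point p p)
      𝒜 = filterᵇ (λ x → does (remains? S i h x)) Xs
      𝒢 = filterᵇ (not ∘ bad S i h) Xs
      ℬ = filterᵇ (bad S i h) Xs

      𝒜⊆Xs : 𝒜 ⊆ Xs
      𝒜⊆Xs = filterᵇ-⊆ (λ x → does (remains? S i h x)) {Xs} {Xs} ⊆-refl

      𝒢⊆Xs : 𝒢 ⊆ Xs
      𝒢⊆Xs = filterᵇ-⊆ (not ∘ bad S i h) {Xs} {Xs} ⊆-refl

      rem : Point p p → Point p p → Bool
      rem T x = does (remains? S i (T Vec.∷ h) x)

      ∣𝒜∣ : length 𝒜 ≡ α
      ∣𝒜∣ = length-filter _ Xs

    -- All sets but the `i`-th stay those of `S`, and `bob-view` keeps the advice of `S`. Each view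
    -- is thus a function of one player's point alone, as the rectangle argument requires.
    alice-view : Point p p → Vec (Subset n) k
    alice-view x = embeds S [ i ]≔ embed x

    bob-view : Point p p → Subset n × List Bool
    bob-view T = embed T , advice S T

    accept : Point p p → Point p p → Bool
    accept x T = accepts ℓ t (alice-view x) (bob-view T)

    -- A remaining `x` comes with an input `S′` that has `x` at `i`, the advice of `S` on `T` and
    -- the first message of `S`. The simulated run is therefore the real run on `S′`, where the
    -- protocol is correct.
    accept-correct : ∀ {x T} → Remains S i (T Vec.∷ h) x → accept x T ≡ disjoint x T
    accept-correct {x} {T} remains with Any.satisfied remains
    ... | S′ , refl , u , m = begin
      accepts ℓ t (alice-view x) (bob-view T)
        ≡⟨ accepts-cong i t (residual-after i (Π i) (embeds S) (proj₂ (restricted i))) ℓ (bob-view T)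
             (trans (Vec.lookup∘updateAt i (embeds S)) (sym (Vec.lookup-map i embed S′))) ⟩
      accepts ℓ t (embeds S′) (bob-view T)
        ≡⟨ cong₂ (λ t a → accepts ℓ t (embeds S′) (embed T , a))
             (residual-cong (Π i) (embeds S) (embeds S′) (sym m)) (sym (Vec.∷-injectiveˡ u)) ⟩
      accepts ℓ t′ (embeds S′) y′
        ≡⟨ accepts≡result t′ (≤-trans (m≤n+m _ (length (opening i S′))) (length-split i S′ T)) ⟩
      result t′ (embeds S′) y′
        ≡⟨ result-residual (Π i) (embeds S′) y′ ⟩
      result (Π i) (embeds S′) y′
        ≡⟨ solves (embeds S′) (embed T) i ⟩
      DISJ (lookup (embeds S′) i) (embed T)
        ≡⟨ cong (λ X → DISJ X (embed T)) (Vec.lookup-map i embed S′) ⟩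
      DISJ (embed x) (embed T)
        ≡⟨ DISJ-embed x T ⟩
      disjoint x T ∎
      where
      open ≡-Reasoning
      t′ = residual (Π i) (embeds S′)
      y′ = embed T , advice S′ T

    good-T : ∀ {T} → T ∈ 𝒢 → bad S i h T ≡ false
    good-T T∈ = not-true⇒false (filter-∈ (not ∘ bad S i h) Xs T∈)

    few-missed : ∀ {T} → bad S i h T ≡ false → 40 * ∑[ x ∈ 𝒜 ] ⟦ not (rem T x) ⟧ ≤ α
    few-missed {T} good = small-loss 39 (<⇒≤ (≰⇒> (does⇒¬ (bad? S i h T) good ∘ inj₁))) αT≤
      (trans (sym (∑-+ 𝒜 _ _)) (trans (∑-cong 𝒜 λ x → ⟦⟧-not (rem T x)) (trans (sym (length≡∑1 𝒜)) ∣𝒜∣)))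
      where
      αT = #remaining S i (T Vec.∷ h)
      kept = ∑[ x ∈ 𝒜 ] ⟦ rem T x ⟧
      αT≤ : αT ≤ kept
      αT≤ = ≤-trans (∑-mono Xs λ x → ⟦does⟧≤ (remains? S i (T Vec.∷ h) x) λ remains → ≤-reflexive (sym (cong₂ (λ b c → ⟦ b ⟧ * ⟦ c ⟧)
          (dec-true (remains? S i h x) (remains-tail remains)) (dec-true (remains? S i (T Vec.∷ h) x) remains))))
        (≤-reflexive (sym (∑-filter (λ x → does (remains? S i h x)) Xs (λ x → ⟦ rem T x ⟧))))

    module _ (N≤4s^p : N ≤ 4 * s ^ p) (gap : 40 ^ r * (8 * (2 ^ ℓ * 2 ^ p)) ≤ 3 ^ p * 39 ^ r) where

      -- The assumption to be refuted. Under it, the rectangle of remaining values and good sets has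
      -- many pairs accepted rightly and few accepted wrongly.
      module FewBad (few-bad : 40 * count (bad S i h) Xs < N) where
        open ≤-Reasoning
        module C = Corruption Xs Xs disjoint (3 ^ p) (2 ^ p * (N * N)) (λ A⊆ B⊆ → corruption A⊆ B⊆) alice-view bob-view
        cB = count (bad S i h) Xs
        right = C.#right ℓ t 𝒜 𝒢
        wrong = C.#wrong ℓ t 𝒜 𝒢
        miss = ∑[ x ∈ 𝒜 ] ∑[ T ∈ 𝒢 ] ⟦ not (rem T x) ⟧
        N≢0 : NonZero N
        N≢0 = m^n≢0 p p
        correct : ∀ x T → rem T x ≡ true → accept x T ≡ disjoint x T
        correct x T eq = accept-correct (does⇒ (remains? S i (T Vec.∷ h) x) eq)
        miss≤ : 40 * miss ≤ N * α
        miss≤ = begin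
          40 * miss                                             ≡⟨ cong (40 *_) (∑-swap 𝒜 𝒢 _) ⟩
          40 * ∑[ T ∈ 𝒢 ] ∑[ x ∈ 𝒜 ] ⟦ not (rem T x) ⟧          ≡⟨ sym (∑-*ˡ 40 𝒢 _) ⟩
          ∑[ T ∈ 𝒢 ] (40 * ∑[ x ∈ 𝒜 ] ⟦ not (rem T x) ⟧)        ≤⟨ ∑-mono∈ 𝒢 (λ {T} T∈ → few-missed {T} (good-T T∈)) ⟩
          ∑[ T ∈ 𝒢 ] α                                          ≤⟨ ∑-⊆ {xs = 𝒢} {ys = Xs} (λ _ → α) 𝒢⊆Xs ⟩
          ∑[ T ∈ Xs ] α                                         ≡⟨ trans (∑-const Xs α) (cong (_* α) (length-points p p)) ⟩
          N * α                                                 ∎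
        wrong≤ : wrong ≤ miss
        wrong≤ = ∑-mono 𝒜 λ x → ∑-mono 𝒢 λ T → wrong⇒missed (correct x T)
        -- Each remaining value is disjoint from at least `s ^ p` sets, and each of these is
        -- accepted rightly, fails to keep the value, or is bad.
        many : α * s ^ p ≤ right + miss + α * cB
        many = begin
          α * s ^ p
            ≡⟨ sym (trans (∑-const 𝒜 (s ^ p)) (cong (_* s ^ p) ∣𝒜∣)) ⟩
          ∑[ x ∈ 𝒜 ] (s ^ p)
            ≤⟨ ∑-mono 𝒜 #disjoint-from ⟩
          ∑[ x ∈ 𝒜 ] ∑[ T ∈ Xs ] ⟦ disjoint x T ⟧
            ≤⟨ ∑-mono 𝒜 from-x ⟩
          ∑[ x ∈ 𝒜 ] (∑[ T ∈ 𝒢 ] ⟦ accept x T ∧ disjoint x T ⟧ + ∑[ T ∈ 𝒢 ] ⟦ not (rem T x) ⟧ + cB)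
            ≡⟨ ∑-+ 𝒜 (λ x → ∑[ T ∈ 𝒢 ] ⟦ accept x T ∧ disjoint x T ⟧ + ∑[ T ∈ 𝒢 ] ⟦ not (rem T x) ⟧) (λ _ → cB) ⟩
          ∑[ x ∈ 𝒜 ] (∑[ T ∈ 𝒢 ] ⟦ accept x T ∧ disjoint x T ⟧ + ∑[ T ∈ 𝒢 ] ⟦ not (rem T x) ⟧) + ∑[ x ∈ 𝒜 ] cB
            ≡⟨ cong₂ _+_ (∑-+ 𝒜 (λ x → ∑[ T ∈ 𝒢 ] ⟦ accept x T ∧ disjoint x T ⟧) (λ x → ∑[ T ∈ 𝒢 ] ⟦ not (rem T x) ⟧))
                 (trans (∑-const 𝒜 cB) (cong (_* cB) ∣𝒜∣)) ⟩
          right + miss + α * cB ∎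
          where
          from-x : ∀ x → ∑[ T ∈ Xs ] ⟦ disjoint x T ⟧ ≤
                         ∑[ T ∈ 𝒢 ] ⟦ accept x T ∧ disjoint x T ⟧ + ∑[ T ∈ 𝒢 ] ⟦ not (rem T x) ⟧ + cB
          from-x x = begin
            ∑[ T ∈ Xs ] d T
              ≡⟨ trans (∑-split (bad S i h) Xs d) (+-comm (∑ ℬ d) (∑ 𝒢 d)) ⟩
            ∑ 𝒢 d + ∑ ℬ d
              ≤⟨ +-mono-≤ (∑-mono 𝒢 λ T → right-or-missed (correct x T)) (∑-mono ℬ λ T → ⟦⟧≤1 (disjoint x T)) ⟩
            ∑[ T ∈ 𝒢 ] (⟦ accept x T ∧ disjoint x T ⟧ + ⟦ not (rem T x) ⟧) + ∑[ T ∈ ℬ ] 1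
              ≡⟨ cong₂ _+_ (∑-+ 𝒢 (λ T → ⟦ accept x T ∧ disjoint x T ⟧) (λ T → ⟦ not (rem T x) ⟧))
                   (trans (sym (length≡∑1 ℬ)) (length-filter (bad S i h) Xs)) ⟩
            ∑[ T ∈ 𝒢 ] ⟦ accept x T ∧ disjoint x T ⟧ + ∑[ T ∈ 𝒢 ] ⟦ not (rem T x) ⟧ + cB ∎
            where
            d : Point p p → ℕ
            d T = ⟦ disjoint x T ⟧
        -- `Small` does not depend on the set, so a single set that is not bad refutes it and yields
        -- `large`.
        some-good : ∃[ T ] bad S i h T ≡ false
        some-good = count<length⇒false (bad S i h) Xs
          (<-≤-trans (≤-<-trans (m≤n*m cB 40) few-bad) (≤-reflexive (sym (length-points p p))))
        large : 39 ^ r * N < 40 ^ r * α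
        large = let T , good = some-good in
          subst (λ M → 39 ^ r * M < 40 ^ r * α) (length-points p p) (≰⇒> (does⇒¬ (bad? S i h T) good ∘ inj₂))
        -- Corruption gives α ≤ 8 · 2^ℓ · (2/3)^p · N, and `gap` puts this below (39/40)^r · N.
        small : 40 ^ r * α * N ≤ 39 ^ r * N * N
        small = *-cancelˡ-≤ (3 ^ p) {{m^n≢0 3 p}} (begin
          3 ^ p * (40 ^ r * α * N)                            ≡⟨ lemma₁ (3 ^ p) (40 ^ r) α N ⟩
          40 ^ r * (3 ^ p * (N * α))                          ≤⟨ *-monoʳ-≤ (40 ^ r) (KNα≤8Z {N} {α} {3 ^ p} {right} {wrong} {miss} {cB} {s ^ p} {2 ^ ℓ * (2 ^ p * (N * N))} many N≤4s^p miss≤ (<⇒≤ few-bad) wrong≤ corrupted) ⟩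
          40 ^ r * (8 * (2 ^ ℓ * (2 ^ p * (N * N))))          ≡⟨ lemma₂ (40 ^ r) (2 ^ ℓ) (2 ^ p) (N * N) ⟩
          40 ^ r * (8 * (2 ^ ℓ * 2 ^ p)) * (N * N)            ≤⟨ *-monoˡ-≤ (N * N) gap ⟩
          3 ^ p * 39 ^ r * (N * N)                            ≡⟨ lemma₃ (3 ^ p) (39 ^ r) N ⟩
          3 ^ p * (39 ^ r * N * N)                            ∎)
          where
          corrupted : 3 ^ p * right ≤ 3 ^ p * (3 * wrong) + 2 ^ ℓ * (2 ^ p * (N * N))
          corrupted = C.tree-corruption ℓ t 𝒜⊆Xs 𝒢⊆Xs
          lemma₁ : ∀ K c α N → K * (c * α * N) ≡ c * (K * (N * α))
          lemma₁ = solve-∀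
          lemma₂ : ∀ c l q M → c * (8 * (l * (q * M))) ≡ c * (8 * (l * q)) * M
          lemma₂ = solve-∀
          lemma₃ : ∀ K a N → K * a * (N * N) ≡ K * (a * N * N)
          lemma₃ = solve-∀

        contradict : ⊥
        contradict = <⇒≱ large (*-cancelʳ-≤ (40 ^ r * α) (39 ^ r * N) N {{N≢0}} small)

      many-bad : length Xs ≤ 40 * count (bad S i h) Xs
      many-bad = ≮⇒≥ λ 40cB<∣Xs∣ → FewBad.contradict (<-≤-trans 40cB<∣Xs∣ (≤-reflexive (length-points p p)))

-- Numerical estimates.

bernoulli : ∀ s m → suc s ^ m * suc s ≤ s ^ m * suc s + m * suc s ^ m
bernoulli s zero    = ≤-reflexive (sym (+-identityʳ _))
bernoulli s (suc m) = begin
  b * X * b                          ≡⟨ *-assoc b X b ⟩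
  b * (X * b)                        ≤⟨ *-monoʳ-≤ b (bernoulli s m) ⟩
  b * (Y * b + m * X)                ≡⟨ lemma₁ s X Y m ⟩
  s * Y * b + (b * Y + m * (b * X))  ≤⟨ +-monoʳ-≤ (s * Y * b) (+-monoˡ-≤ (m * (b * X)) (*-monoʳ-≤ b (^-monoˡ-≤ m (n≤1+n s)))) ⟩
  s * Y * b + suc m * (b * X)        ∎
  where
  open ≤-Reasoning
  b = suc s
  X = b ^ m
  Y = s ^ m
  lemma₁ : ∀ s X Y m → (1 + s) * (Y * (1 + s) + m * X) ≡ s * Y * (1 + s) + ((1 + s) * Y + m * ((1 + s) * X))
  lemma₁ = solve-∀

-- (1 - 1/p)^p ≥ 1/4, where p = 1 + s = 2m
p^p≤4s^p : ∀ s m → suc s ≡ 2 * m → suc s ^ suc s ≤ 4 * s ^ suc s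
p^p≤4s^p s m@(suc _) p≡2m = begin
  suc s ^ suc s                ≡⟨ cong (suc s ^_) p≡m+m ⟩
  suc s ^ (m + m)              ≡⟨ ^-distribˡ-+-* (suc s) m m ⟩
  X * X                        ≤⟨ *-mono-≤ X≤2Y X≤2Y ⟩
  2 * Y * (2 * Y)              ≡⟨ lemma Y ⟩
  4 * (Y * Y)                  ≡⟨ cong (4 *_) (sym (^-distribˡ-+-* s m m)) ⟩
  4 * s ^ (m + m)              ≡⟨ cong (λ e → 4 * s ^ e) (sym p≡m+m) ⟩
  4 * s ^ suc s                ∎
  where
  open ≤-Reasoning
  X = suc s ^ m
  Y = s ^ m
  p≡m+m : suc s ≡ m + m
  p≡m+m = trans p≡2m (cong (m +_) (+-identityʳ m))
  lemma : ∀ Y → 2 * Y * (2 * Y) ≡ 4 * (Y * Y)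
  lemma = solve-∀
  lemma₁ : ∀ m X → m * X + m * X ≡ X * (2 * m)
  lemma₁ = solve-∀
  lemma₂ : ∀ m Y → Y * (2 * m) ≡ m * (2 * Y)
  lemma₂ = solve-∀
  -- `bernoulli` is (1 - 1/p)^m ≥ 1 - m/p cleared of denominators; with p = 2m the right side is
  -- 1/2.
  X≤2Y : X ≤ 2 * Y
  X≤2Y = *-cancelˡ-≤ m (+-cancelʳ-≤ (m * X) _ _ (begin
    m * X + m * X              ≡⟨ lemma₁ m X ⟩
    X * (2 * m)                ≡⟨ cong (X *_) (sym p≡2m) ⟩
    X * suc s                  ≤⟨ bernoulli s m ⟩
    Y * suc s + m * X          ≡⟨ cong (λ b → Y * b + m * X) p≡2m ⟩
    Y * (2 * m) + m * X        ≡⟨ cong (_+ m * X) (lemma₂ m Y) ⟩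
    m * (2 * Y) + m * X        ∎))

^-*-≤ : ∀ {a b c d} L → a * b ≤ c * d → a ^ L * b ^ L ≤ c ^ L * d ^ L
^-*-≤ {a} {b} {c} {d} L h = subst₂ _≤_ (*-^ a b L) (*-^ c d L) (^-monoˡ-≤ L h)

-- Checked by evaluation. In logarithms, 3200 ln(40/39) + ln 8 is about 83, below 256 ln(3/2), about
-- 104.
numeric-gap : 40 ^ 3200 * (8 * 2 ^ 256) ≤ 3 ^ 256 * 39 ^ 3200
numeric-gap = ≤ᵇ⇒≤ (40 ^ 3200 * (8 * 2 ^ 256)) (3 ^ 256 * 39 ^ 3200) tt

-- The `L`-th power of `numeric-gap`. Enlarging `2 ^ ℓ` to `8 ^ ℓ` lets the single factor 8 complete
-- `8 ^ L`.
gap : ∀ ℓ → let L = suc ℓ in 40 ^ (3200 * L) * (8 * (2 ^ ℓ * 2 ^ (256 * L))) ≤ 3 ^ (256 * L) * 39 ^ (3200 * L)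
gap ℓ = begin
  40 ^ (3200 * L) * (8 * (2 ^ ℓ * 2 ^ (256 * L)))
    ≤⟨ *-monoʳ-≤ (40 ^ (3200 * L)) (*-monoʳ-≤ 8 (*-monoˡ-≤ (2 ^ (256 * L)) (^-monoˡ-≤ ℓ (≤ᵇ⇒≤ 2 8 tt)))) ⟩
  40 ^ (3200 * L) * (8 * (8 ^ ℓ * 2 ^ (256 * L)))
    ≡⟨ cong₂ _*_ (sym (^-*-assoc 40 3200 L)) (trans (sym (*-assoc 8 (8 ^ ℓ) _))
         (trans (cong (8 ^ L *_) (sym (^-*-assoc 2 256 L))) (sym (*-^ 8 (2 ^ 256) L)))) ⟩
  (40 ^ 3200) ^ L * (8 * 2 ^ 256) ^ L
    ≤⟨ ^-*-≤ {40 ^ 3200} {8 * 2 ^ 256} {3 ^ 256} {39 ^ 3200} L numeric-gap ⟩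
  (3 ^ 256) ^ L * (39 ^ 3200) ^ L
    ≡⟨ cong₂ _*_ (^-*-assoc 3 256 L) (^-*-assoc 39 3200 L) ⟩
  3 ^ (256 * L) * 39 ^ (3200 * L) ∎
  where
  open ≤-Reasoning
  L = suc ℓ

n<2^n : ∀ n → n < 2 ^ n
n<2^n zero    = s≤s z≤n
n<2^n (suc n) = ≤-trans (+-mono-≤ (m^n>0 2 n) (n<2^n n)) (≤-reflexive (cong (2 ^ n +_) (sym (+-identityʳ (2 ^ n)))))

^-cancelˡ-≤ : ∀ {m n} → 2 ^ m ≤ 2 ^ n → m ≤ n
^-cancelˡ-≤ h = ≮⇒≥ λ n<m → <⇒≱ (^-monoʳ-< 2 (s≤s (s≤s z≤n)) n<m) h

-- Short transcripts force few indices.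

module _ {n k : ℕ} (Γ : Protocol n k) (restricted : Restricted Γ) (solves : Solves-SEL-DISJ Γ)
  {ℓ u : ℕ} (Π≤ : ∀ i → ∣Π∣ Γ i ≤ ℓ) (U≤ : ∣U∣ Γ ≤ u) where

  private
    L = suc ℓ
    r = 3200 * L

  module _ {s : ℕ} (p≡256L : suc s ≡ 256 * L) (p²≤n : suc s * suc s ≤ n) where

    private
      p = suc s
      -- w = r k / 40 drops by 39 / 40 each gain 2 L k bits, as (40 / 39) ^ 80 ≥ 4;
      -- the first messages account for only half of them.
      w = 80 * (L * k)
      module R = Reduction Γ restricted solves {s} (embedding p p n p²≤n) {ℓ} {u} Π≤ U≤ r

      p^p≤2^n : p ^ p ≤ 2 ^ n
      p^p≤2^n = begin
        p ^ p          ≤⟨ ^-monoˡ-≤ p (<⇒≤ (n<2^n p)) ⟩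
        (2 ^ p) ^ p    ≡⟨ ^-*-assoc 2 p p ⟩
        2 ^ (p * p)    ≤⟨ ^-monoʳ-≤ 2 p²≤n ⟩
        2 ^ n          ∎
        where open ≤-Reasoning

      0<∣points∣ : 0 < length (points p p)
      0<∣points∣ = <-≤-trans (m^n>0 p p) (≤-reflexive (sym (length-points p p)))

      gap′ : 40 ^ r * (8 * (2 ^ ℓ * 2 ^ p)) ≤ 3 ^ p * 39 ^ r
      gap′ = subst (λ q → 40 ^ r * (8 * (2 ^ ℓ * 2 ^ q)) ≤ 3 ^ q * 39 ^ r) (sym p≡256L) (gap ℓ)

      p≡2m : p ≡ 2 * (128 * L)
      p≡2m = trans p≡256L (*-assoc 2 128 L)

      w*40≡r*k : w * 40 ≡ r * k
      w*40≡r*k = lemma L k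
        where
        lemma : ∀ L k → 80 * (L * k) * 40 ≡ 3200 * L * k
        lemma = solve-∀

      labels-bound : 40 ^ w ≤ length (points p p) ^ r * (length (strings u) ^ r * length (strings ℓ) ^ k) * 39 ^ w
      labels-bound = R.labels-lower-bound 0<∣points∣ 0<∣points∣ 40
        (λ S i h → R.many-bad S i h (p^p≤4s^p s (128 * L) p≡2m) gap′) w (≤-reflexive w*40≡r*k)

      bits : ℕ
      bits = n * r + (suc u * r + L * k)

      labels≤ : length (points p p) ^ r * (length (strings u) ^ r * length (strings ℓ) ^ k) ≤ 2 ^ bits
      labels≤ = begin
        length (points p p) ^ r * (length (strings u) ^ r * length (strings ℓ) ^ k)
          ≤⟨ *-mono-≤ (^-monoˡ-≤ r (≤-trans (≤-reflexive (length-points p p)) p^p≤2^n))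
               (*-mono-≤ (^-monoˡ-≤ r (<⇒≤ (length-strings u))) (^-monoˡ-≤ k (<⇒≤ (length-strings ℓ)))) ⟩
        (2 ^ n) ^ r * ((2 ^ suc u) ^ r * (2 ^ L) ^ k)
          ≡⟨ cong₂ _*_ (^-*-assoc 2 n r) (cong₂ _*_ (^-*-assoc 2 (suc u) r) (^-*-assoc 2 L k)) ⟩
        2 ^ (n * r) * (2 ^ (suc u * r) * 2 ^ (L * k))
          ≡⟨ sym (trans (^-distribˡ-+-* 2 (n * r) _) (cong (2 ^ (n * r) *_) (^-distribˡ-+-* 2 (suc u * r) _))) ⟩
        2 ^ bits ∎
        where open ≤-Reasoning

      4^*39^≤40^ : 2 ^ (2 * (L * k)) * 39 ^ w ≤ 40 ^ w
      4^*39^≤40^ = begin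
        2 ^ (2 * (L * k)) * 39 ^ w              ≡⟨ cong₂ _*_ (sym (^-*-assoc 2 2 (L * k))) (sym (^-*-assoc 39 80 (L * k))) ⟩
        (2 ^ 2) ^ (L * k) * (39 ^ 80) ^ (L * k) ≡⟨ sym (*-^ (2 ^ 2) (39 ^ 80) (L * k)) ⟩
        (2 ^ 2 * 39 ^ 80) ^ (L * k)             ≤⟨ ^-monoˡ-≤ (L * k) (≤ᵇ⇒≤ (2 ^ 2 * 39 ^ 80) (40 ^ 80) tt) ⟩
        (40 ^ 80) ^ (L * k)                     ≡⟨ ^-*-assoc 40 80 (L * k) ⟩
        40 ^ w                                  ∎
        where open ≤-Reasoning

    -- Comparing exponents of 2 in the two bounds on labels gives `2 * (L * k) ≤ bits`. One `L * k`
    -- cancels against the first messages, and then the common factor `L`, so the bound no longer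
    -- mentions `ℓ`.
    few-indices : k ≤ 3200 * (n + suc u)
    few-indices = *-cancelˡ-≤ L (+-cancelʳ-≤ (L * k) _ _ (begin
      L * k + L * k                          ≡⟨ lemma₁ (L * k) ⟩
      2 * (L * k)                            ≤⟨ ^-cancelˡ-≤ (*-cancelʳ-≤ _ _ (39 ^ w) {{m^n≢0 39 w}}
                                                  (≤-trans 4^*39^≤40^ (≤-trans labels-bound (*-monoˡ-≤ (39 ^ w) labels≤)))) ⟩
      bits                                   ≡⟨ lemma₂ L k n u ⟩
      L * (3200 * (n + suc u)) + L * k       ∎))
      where
      open ≤-Reasoning
      lemma₁ : ∀ x → x + x ≡ 2 * x
      lemma₁ = solve-∀
      lemma₂ : ∀ L k n u → n * (3200 * L) + ((1 + u) * (3200 * L) + L * k) ≡ L * (3200 * (n + (1 + u))) + L * k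
      lemma₂ = solve-∀

-- The choice of `ℓ` and the final constants.

scaled-sqrt : ∀ d .{{_ : NonZero d}} n → ∃[ L ] (d * L) * (d * L) ≤ n × n < (d * suc L) * (d * suc L)
scaled-sqrt d zero    = 0 , ≤-reflexive (trans (cong (d * 0 *_) (*-zeroʳ d)) (*-zeroʳ (d * 0))) ,
  *-mono-≤ {1} {d * 1} {1} {d * 1} d≥1 d≥1
  where
  d≥1 : 1 ≤ d * 1
  d≥1 = ≤-trans (>-nonZero⁻¹ d) (≤-reflexive (sym (*-identityʳ d)))
scaled-sqrt d (suc n) with scaled-sqrt d n
... | L , l , u with (d * suc L) * (d * suc L) ≤? suc n
...   | yes h = suc L , h , ≤-<-trans u (*-mono-< step step)
  where
  step : d * suc L < d * suc (suc L)
  step = *-monoʳ-< d ≤-refl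
...   | no h  = L , m≤n⇒m≤1+n l , ≰⇒> h

-- `suc ℓ` is the integer part of √n / d; the hypothesis makes it positive.
scaled-sqrt⁺ : ∀ d .{{_ : NonZero d}} n → d * d ≤ n →
               ∃[ ℓ ] (d * suc ℓ) * (d * suc ℓ) ≤ n × n < (d * suc (suc ℓ)) * (d * suc (suc ℓ))
scaled-sqrt⁺ d n d²≤n with scaled-sqrt d n
... | zero  , _ , u = contradiction d²≤n (<⇒≱ (≤-trans u (≤-reflexive (cong (λ e → e * e) (*-identityʳ d)))))
... | suc ℓ , l , u = ℓ , l , u

+-≤⇒parts-≤ : ∀ a b c {n} → a + (b + c) ≤ n → a ≤ n × b ≤ n × c ≤ n
+-≤⇒parts-≤ a b c h = m+n≤o⇒m≤o a h , m+n≤o⇒m≤o b h′ , m+n≤o⇒n≤o b h′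
  where h′ = m+n≤o⇒n≤o a h

≥√-intro : ∀ {x n} → n ≤ 512 * x * (512 * x) → x ≥ ℤ.+ 1 ℚ./ 512 √ n
≥√-intro {x} {n} h = ℚ.toℚᵘ-cancel-≤ (ℚᵘ.≤-respˡ-≃ (ℚᵘ.≃-sym lhs) (ℚᵘ.≤-respʳ-≃ (ℚᵘ.≃-sym rhs) (ℚᵘ.*≤* ineq)))
  where
  c = ℤ.+ 1 ℚ./ 512
  -- The square of 512 is 262144, and `mkℚᵘ` stores a denominator minus one.
  lhs : ℚ.toℚᵘ ((c ℚ.* c) ℚ.* ℕ→ℚ n) ℚᵘ.≃ ℚᵘ.mkℚᵘ (ℤ.+ 1) 262143 ℚᵘ.* ℚᵘ.mkℚᵘ (ℤ.+ n) 0
  lhs = ℚᵘ.≃-trans (ℚ.toℚᵘ-homo-* (c ℚ.* c) (ℕ→ℚ n)) (ℚᵘ.*-congˡ {ℚ.toℚᵘ (c ℚ.* c)} (ℚ.toℚᵘ-fromℚᵘ (ℚᵘ.mkℚᵘ (ℤ.+ n) 0)))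
  rhs : ℚ.toℚᵘ (ℕ→ℚ (x * x)) ℚᵘ.≃ ℚᵘ.mkℚᵘ (ℤ.+ (x * x)) 0
  rhs = ℚ.toℚᵘ-fromℚᵘ (ℚᵘ.mkℚᵘ (ℤ.+ (x * x)) 0)
  open ℤ.≤-Reasoning
  ineq : (ℤ.+ 1 ℤ.* ℤ.+ n) ℤ.* ℤ.+ 1 ℤ.≤ ℤ.+ (x * x) ℤ.* ℤ.+ 262144
  ineq = begin
    (ℤ.+ 1 ℤ.* ℤ.+ n) ℤ.* ℤ.+ 1     ≡⟨ trans (ℤ.*-identityʳ _) (ℤ.*-identityˡ (ℤ.+ n)) ⟩
    ℤ.+ n                       ≤⟨ ℤ.+≤+ (≤-trans h (≤-reflexive (lemma x))) ⟩
    ℤ.+ (x * x * 262144)        ≡⟨ ℤ.pos-* (x * x) 262144 ⟩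
    ℤ.+ (x * x) ℤ.* ℤ.+ 262144    ∎
    where
    lemma : ∀ x → 512 * x * (512 * x) ≡ x * x * 262144
    lemma x = trans ([m*n]*[o*p]≡[m*o]*[n*p] 512 x 512 x) (*-comm 262144 (x * x))

-- With `d = 256` this is the source of the constant 1/512: √n is below `256 * suc (suc ℓ)`, and
-- rounding up at most doubles `x`.
next-multiple : ∀ d {ℓ x} → suc ℓ ≤ x → d * suc (suc ℓ) ≤ d * 2 * x
next-multiple d {ℓ} {x} h = begin
  d * suc (suc ℓ)  ≤⟨ *-monoʳ-≤ d (≤-trans (s≤s h) (≤-trans (+-monoˡ-≤ x (≤-trans (s≤s z≤n) h)) (≤-reflexive (cong (x +_) (sym (+-identityʳ x)))))) ⟩
  d * (2 * x)      ≡⟨ sym (*-assoc d 2 x) ⟩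
  d * 2 * x        ∎
  where open ≤-Reasoning

-- As `1 ≤ n`, `4 * k` is at most 4c(2n + u), which the last two bounds make at most `3 * k`. So `k`
-- is 0, although `4 * c * n` is positive.
few-indices-absurd : ∀ c {n k u} → 1 ≤ c → 1 ≤ n → k ≤ c * (n + suc u) → 4 * c * n ≤ k → 4 * c * u ≤ k → ⊥
few-indices-absurd c {n} {k} {u} c≥1 n≥1 few Cn≤k Cu≤k = <⇒≱ (*-mono-≤ {1} {4 * c} (*-mono-≤ {1} {4} (s≤s z≤n) c≥1) n≥1)
  (≤-trans Cn≤k (+-cancelʳ-≤ (3 * k) k 0 (begin
    k + 3 * k                                     ≡⟨⟩
    4 * k                                         ≤⟨ *-monoʳ-≤ 4 (≤-trans few (*-monoʳ-≤ c (+-monoʳ-≤ n (+-monoˡ-≤ u n≥1)))) ⟩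
    4 * (c * (n + (n + u)))                       ≡⟨ lemma c n u ⟩
    4 * c * n + (4 * c * n + (4 * c * u + 0))     ≤⟨ +-mono-≤ Cn≤k (+-mono-≤ Cn≤k (+-monoˡ-≤ 0 Cu≤k)) ⟩
    3 * k                                         ∎)))
  where
  open ≤-Reasoning
  lemma : ∀ c n u → 4 * (c * (n + (n + u))) ≡ 4 * c * n + (4 * c * n + (4 * c * u + 0))
  lemma = solve-∀

long-or-few : ∀ {n k} (Γ : Protocol n k) → Restricted Γ → Solves-SEL-DISJ Γ →
              ∀ ℓ → (256 * suc ℓ) * (256 * suc ℓ) ≤ n →
              (∃[ i ] suc ℓ ≤ ∣Π∣ Γ i) ⊎ k ≤ 3200 * (n + suc (∣U∣ Γ))
long-or-few Γ restricted solves ℓ p²≤n = map₂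
  -- `256 * suc ℓ` computes to a successor, so its predecessor serves as `s` and the equation for p
  -- holds by `refl`.
  (λ short → few-indices Γ restricted solves (λ i → ≮⇒≥ λ ℓ<Π → short (i , ℓ<Π)) ≤-refl {pred (256 * suc ℓ)} refl p²≤n)
  (toSum (Fin.any? λ i → suc ℓ ≤? ∣Π∣ Γ i))

long-transcript : ∀ {n k} (Γ : Protocol n k) → Restricted Γ → Solves-SEL-DISJ Γ →
                  256 * 256 ≤ n → 12800 * n ≤ k → 12800 * ∣U∣ Γ ≤ k → ∃[ i ] (∣Π∣ Γ i ≥ ℤ.+ 1 ℚ./ 512 √ n)
long-transcript {n} Γ restricted solves n≥ Cn≤k Cu≤k =
  let ℓ , p²≤n , n< = scaled-sqrt⁺ 256 n n≥
  in [ (λ (i , long) → let step = next-multiple 256 long in i , ≥√-intro {∣Π∣ Γ i} (≤-trans (<⇒≤ n<) (*-mono-≤ step step)))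
     , (λ few → ⊥-elim (few-indices-absurd 3200 (s≤s z≤n) (≤-trans (s≤s z≤n) n≥) few Cn≤k Cu≤k))
     ]′ (long-or-few Γ restricted solves ℓ p²≤n)

theorem1p2 :
    (k : ℕ → ℕ) →
    k is-ω (λ n → n) →
    (Γ : ∀ n → Protocol n (k n)) →
    (∀ n → Restricted (Γ n)) →
    (∀ n → Solves-SEL-DISJ (Γ n)) →
    (λ n → ∣U∣ (Γ n)) is-o k →
    ∃[ c ] (0ℚ ℚ.< c × ∃[ n₀ ] (∀ n → n ≥ n₀ → ∃[ i ] (∣Π∣ (Γ n) i ≥ c √ n)))
theorem1p2 k k≫n Γ restricted solves ∣U∣≪k =
  -- 12800 is four times the 3200 of `few-indices`, as `few-indices-absurd` asks; `256 * 256`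
  -- ensures that `ℓ` exists.
  let N₁ , k≥Cn = k≫n 12800
      N₂ , k≥Cu = ∣U∣≪k 12800
  in ℤ.+ 1 ℚ./ 512 , ℚ.*<* (ℤ.+<+ (s≤s z≤n)) , 256 * 256 + (N₁ + N₂) , λ n n≥ →
    let n≥256² , n≥N₁ , n≥N₂ = +-≤⇒parts-≤ (256 * 256) N₁ N₂ n≥
    in long-transcript (Γ n) (restricted n) (solves n) n≥256² (k≥Cn n n≥N₁) (k≥Cu n n≥N₂)
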